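{- Let $p$ be a prime with $p > 32$. Then there is no polynomial $f \in \mathbb{F}_p[x]$ of degree exactly $\frac{p+1}{2}$ whose range sum equals $p$, i.e. such that $\sum_{x \in \mathbb{F}_p} f(x) = p$, where each value $f(x)$ is regarded as an integer in $\{0,1,\ldots,p-1\}$ and the sum is taken in $\mathbb{Z}$.
   Context: $\mathbb{F}_p$ denotes the field with $p$ elements, $p$ prime. Elements of $\mathbb{F}_p$ are identified with the integers $\{0,1,\ldots,p-1\}$; for $f \in \mathbb{F}_p[x]$, the range sum of $f$ is the integer $\sum_{x\in\mathbb{F}_p} f(x)$ computed in $\mathbb{Z}$ under this identification. -}

module Defs where

open import Data.Nat using (ℕ; zero; suc; _+_; _*_; _%_; NonZero)
open import Data.Fin using (Fin; toℕ)
open import Data.Vec using (Vec; []; _∷_; last)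
open import Data.List using (List; map; upTo)
open import Data.Nat.ListAction using (sum)
open import Relation.Nullary using (¬_)
open import Relation.Binary.PropositionalEquality using (_≡_)

-- A polynomial over F_p of degree exactly d: its coefficient vector
-- (c₀, c₁, …, c_d), constant term first, with coefficients in Fin p ≅ F_p.
-- "Degree exactly d" is the separate condition that the last coefficient
-- is nonzero (see 'HasDegree').

evalℕ : ∀ {p n} → Vec (Fin p) n → ℕ → ℕ
evalℕ []       x = 0
evalℕ (c ∷ cs) x = toℕ c + x * evalℕ cs x

evalFp : ∀ {p n} .{{_ : NonZero p}} → Vec (Fin p) n → ℕ → ℕ
evalFp {p} cs x = evalℕ cs x % p

HasDegree : ∀ {p} d → Vec (Fin p) (suc d) → Set
HasDegree d cs = ¬ (toℕ (last cs) ≡ 0)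

rangeSum : ∀ {p n} .{{_ : NonZero p}} → Vec (Fin p) n → ℕ
rangeSum {p} cs = sum (map (evalFp cs) (upTo p))

{-# OPTIONS --safe #-}

-- Let w(x) ∈ {0,…,p−1} be the value f(x), d = (p+1)/2 the degree of f, and put
-- D = ∏ (X − x) = X^p − X and F = ∏ (X − x)^w(x), both monic of degree p.
-- Lagrange interpolation gives D F′ = − f F, so F′ has degree d, hence V = F − D
-- has degree d + 1.  Then q = F′ + f satisfies q F = V F′, so q has degree
-- 2d + 1 − p = 2.  Where w(x) ≥ 2, F has a double root and q(x) = f(x); so every
-- value ≥ 2 is taken at most twice, while 0 is taken at most d times.  As the w(x)
-- have average 1, this forces 4k ≤ d + 12 for the number k of x with w(x) ≥ 2,
-- and 2k + 2 < d once p > 32.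
--
-- Let P be the product of X − x over these k points.  All other values are 0 or 1,
-- so f (f − 1) P = D E with deg E = k + 1.  Differentiating, multiplying by 4E and
-- using (2f − 1)² = 4 f (f − 1) + 1 exhibits − 4E² + E P′ − E′ P as a multiple of
-- 2f − 1.  It has degree exactly 2k + 2 < d = deg (2f − 1), a contradiction.

module Submission where

open import Algebra.Bundles using (CommutativeRing; RawRing)
open import Algebra.Morphism.Structures using (IsRingMonomorphism)
import Algebra.Morphism.RingMonomorphism as RingMonomorphism
import Algebra.Properties.CommutativeMonoid.Mult as CommutativeMonoidMult
import Algebra.Properties.Ring as RingProperties
import Algebra.Properties.Semiring.Exp as SemiringExp
import Algebra.Properties.Semiring.Mult as SemiringMult
import Algebra.Solver.Ring.NaturalCoefficients.Default as NaturalSolver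
open import Algebra.Structures using (IsCommutativeRing)
open import Data.Empty using (⊥; ⊥-elim)
open import Data.Integer as ℤ using (ℤ; +_)
import Data.Integer.Divisibility.Signed as ℤ
import Data.Integer.Properties as ℤ
import Data.Integer.Solver as ℤSolver
open import Data.List using (List; []; _∷_; map; length; filter; upTo)
open import Data.List.Membership.Propositional using (_∈_)
open import Data.List.Membership.Propositional.Properties using (∈-map⁺; ∈-filter⁺; ∈-filter⁻; ∈-upTo⁻)
open import Data.List.Properties using (length-map; length-upTo)
open import Data.List.Relation.Unary.All using (All; []; _∷_)
import Data.List.Relation.Unary.All as All
import Data.List.Relation.Unary.All.Properties as All
open import Data.List.Relation.Unary.AllPairs using (AllPairs; []; _∷_)
open import Data.List.Relation.Unary.Any using (here; there)
open import Data.List.Relation.Unary.Unique.Propositional using (Unique)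
open import Data.List.Relation.Unary.Unique.Propositional.Properties using (upTo⁺; filter⁺)
open import Data.Nat as ℕ using (ℕ; zero; suc; _≤_; _<_; z≤n; s≤s)
open import Data.Nat.Divisibility using (_∣_; >⇒∤; m%n≡0⇒n∣m)
open import Data.Nat.DivMod using (_%_; m≡m%n+[m/n]*n; m%n<n; m*n/n≡m)
open import Data.Nat.ListAction using (sum)
import Data.Nat.Properties as ℕ
import Data.Nat.Solver as ℕSolver
open import Data.Product using (∃; _,_; _×_; proj₁; proj₂)
open import Data.Sum using (inj₁; inj₂)
open import Relation.Binary.Definitions using (Tri; tri<; tri≈; tri>)
open import Relation.Binary.PropositionalEquality using (_≡_)
import Relation.Binary.PropositionalEquality as ≡
import Relation.Binary.Reasoning.Setoid as SetoidReasoning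
open import Relation.Nullary using (¬_; yes; no)
open import Relation.Unary using (Decidable)

-- Formal power series over a commutative ring

module PowerSeries {c ℓ} (R : CommutativeRing c ℓ) where

  open CommutativeRing R
  open NaturalSolver commutativeSemiring using (solve; _:=_; _:+_; _:*_)
  open SetoidReasoning setoid

  Series : Set c
  Series = ℕ → Carrier

  infix 4 _≋_
  _≋_ : Series → Series → Set ℓ
  f ≋ g = ∀ i → f i ≈ g i

  tail : Series → Series
  tail f i = f (suc i)

  0ₛ 1ₛ : Series
  0ₛ _ = 0#
  1ₛ zero    = 1#
  1ₛ (suc _) = 0#

  infixl 6 _+ₛ_
  infixl 7 _*ₛ_ _·ₛ_
  -- The product is the Cauchy product, computed by splitting off the constant term of the left
  -- factor: `f` is `f 0` plus X times `tail f`.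
  _+ₛ_ _*ₛ_ : Series → Series → Series
  (f +ₛ g) i = f i + g i
  (f *ₛ g) zero    = f 0 * g 0
  (f *ₛ g) (suc i) = f 0 * g (suc i) + (tail f *ₛ g) i

  -ₛ_ : Series → Series
  (-ₛ f) i = - f i

  _·ₛ_ : Carrier → Series → Series
  (a ·ₛ f) i = a * f i

  *ₛ-cong : ∀ {f f′ g g′} → f ≋ f′ → g ≋ g′ → f *ₛ g ≋ f′ *ₛ g′
  *ₛ-cong p q zero    = *-cong (p 0) (q 0)
  *ₛ-cong p q (suc i) = +-cong (*-cong (p 0) (q (suc i))) (*ₛ-cong (λ j → p (suc j)) q i)

  *ₛ-zeroˡ : ∀ g → 0ₛ *ₛ g ≋ 0ₛ
  *ₛ-zeroˡ g zero    = zeroˡ _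
  *ₛ-zeroˡ g (suc i) = trans (+-cong (zeroˡ _) (*ₛ-zeroˡ g i)) (+-identityˡ _)

  *ₛ-identityˡ : ∀ g → 1ₛ *ₛ g ≋ g
  *ₛ-identityˡ g zero    = *-identityˡ _
  *ₛ-identityˡ g (suc i) = trans (+-cong (*-identityˡ _) (*ₛ-zeroˡ g i)) (+-identityʳ _)

  -- The mirror image of the defining recursion, splitting off the constant term of the right
  -- factor. Together the two recursions give commutativity.
  *ₛ-sucʳ : ∀ f g i → (f *ₛ g) (suc i) ≈ f (suc i) * g 0 + (f *ₛ tail g) i
  *ₛ-sucʳ f g zero    = +-comm _ _
  *ₛ-sucʳ f g (suc i) = begin
    f 0 * g (suc (suc i)) + (tail f *ₛ g) (suc i)
      ≈⟨ +-congˡ (*ₛ-sucʳ (tail f) g i) ⟩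
    f 0 * g (suc (suc i)) + (f (suc (suc i)) * g 0 + (tail f *ₛ tail g) i)
      ≈⟨ solve 3 (λ a b c → a :+ (b :+ c) := b :+ (a :+ c)) refl _ _ _ ⟩
    f (suc (suc i)) * g 0 + (f *ₛ tail g) (suc i) ∎

  *ₛ-comm : ∀ f g → f *ₛ g ≋ g *ₛ f
  *ₛ-comm f g zero    = *-comm _ _
  *ₛ-comm f g (suc i) = begin
    f 0 * g (suc i) + (tail f *ₛ g) i ≈⟨ +-cong (*-comm _ _) (*ₛ-comm (tail f) g i) ⟩
    g (suc i) * f 0 + (g *ₛ tail f) i ≈⟨ *ₛ-sucʳ g f i ⟨
    (g *ₛ f) (suc i)                  ∎

  *ₛ-distribʳ : ∀ h f g → (f +ₛ g) *ₛ h ≋ f *ₛ h +ₛ g *ₛ h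
  *ₛ-distribʳ h f g zero    = distribʳ _ _ _
  *ₛ-distribʳ h f g (suc i) = begin
    (f 0 + g 0) * h (suc i) + ((tail f +ₛ tail g) *ₛ h) i
      ≈⟨ +-congˡ (*ₛ-distribʳ h (tail f) (tail g) i) ⟩
    (f 0 + g 0) * h (suc i) + ((tail f *ₛ h) i + (tail g *ₛ h) i)
      ≈⟨ solve 5 (λ a b c x y → (a :+ b) :* c :+ (x :+ y) := (a :* c :+ x) :+ (b :* c :+ y))
           refl _ _ _ _ _ ⟩
    (f *ₛ h) (suc i) + (g *ₛ h) (suc i) ∎

  *ₛ-distribˡ : ∀ h f g → h *ₛ (f +ₛ g) ≋ h *ₛ f +ₛ h *ₛ g
  *ₛ-distribˡ h f g i = begin
    (h *ₛ (f +ₛ g)) i         ≈⟨ *ₛ-comm h (f +ₛ g) i ⟩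
    ((f +ₛ g) *ₛ h) i         ≈⟨ *ₛ-distribʳ h f g i ⟩
    (f *ₛ h) i + (g *ₛ h) i   ≈⟨ +-cong (*ₛ-comm f h i) (*ₛ-comm g h i) ⟩
    (h *ₛ f) i + (h *ₛ g) i   ∎

  ·ₛ-*ₛ : ∀ a f g → (a ·ₛ f) *ₛ g ≋ a ·ₛ (f *ₛ g)
  ·ₛ-*ₛ a f g zero    = *-assoc _ _ _
  ·ₛ-*ₛ a f g (suc i) = begin
    a * f 0 * g (suc i) + ((a ·ₛ tail f) *ₛ g) i
      ≈⟨ +-cong (*-assoc _ _ _) (·ₛ-*ₛ a (tail f) g i) ⟩
    a * (f 0 * g (suc i)) + a * (tail f *ₛ g) i
      ≈⟨ distribˡ _ _ _ ⟨
    a * (f *ₛ g) (suc i) ∎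

  *ₛ-assoc : ∀ f g h → (f *ₛ g) *ₛ h ≋ f *ₛ (g *ₛ h)
  *ₛ-assoc f g h zero    = *-assoc _ _ _
  *ₛ-assoc f g h (suc i) = begin
    f 0 * g 0 * h (suc i) + ((f 0 ·ₛ tail g +ₛ tail f *ₛ g) *ₛ h) i
      ≈⟨ +-congˡ (*ₛ-distribʳ h (f 0 ·ₛ tail g) (tail f *ₛ g) i) ⟩
    f 0 * g 0 * h (suc i) + (((f 0 ·ₛ tail g) *ₛ h) i + ((tail f *ₛ g) *ₛ h) i)
      ≈⟨ +-congˡ (+-cong (·ₛ-*ₛ (f 0) (tail g) h i) (*ₛ-assoc (tail f) g h i)) ⟩
    f 0 * g 0 * h (suc i) + (f 0 * (tail g *ₛ h) i + (tail f *ₛ (g *ₛ h)) i)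
      ≈⟨ solve 5 (λ a b c x y → a :* b :* c :+ (a :* x :+ y) := a :* (b :* c :+ x) :+ y)
           refl _ _ _ _ _ ⟩
    (f *ₛ (g *ₛ h)) (suc i) ∎

  series-isCommutativeRing : IsCommutativeRing _≋_ _+ₛ_ _*ₛ_ -ₛ_ 0ₛ 1ₛ
  series-isCommutativeRing = record
    { isRing = record
      { +-isAbelianGroup = record
        { isGroup = record
          { isMonoid = record
            { isSemigroup = record
              { isMagma = record
                { isEquivalence = record
                  { refl  = λ _ → refl
                  ; sym   = λ p i → sym (p i)
                  ; trans = λ p q i → trans (p i) (q i)
                  }
                ; ∙-cong = λ p q i → +-cong (p i) (q i)
                }
              ; assoc = λ f g h i → +-assoc (f i) (g i) (h i)
              }
            ; identity = (λ f i → +-identityˡ (f i)) , (λ f i → +-identityʳ (f i))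
            }
          ; inverse = (λ f i → -‿inverseˡ (f i)) , (λ f i → -‿inverseʳ (f i))
          ; ⁻¹-cong = λ p i → -‿cong (p i)
          }
        ; comm = λ f g i → +-comm (f i) (g i)
        }
      ; *-cong     = *ₛ-cong
      ; *-assoc    = *ₛ-assoc
      ; *-identity = *ₛ-identityˡ , λ f i → trans (*ₛ-comm f 1ₛ i) (*ₛ-identityˡ f i)
      ; distrib    = *ₛ-distribˡ , *ₛ-distribʳ
      }
    ; *-comm = *ₛ-comm
    }

  seriesRawRing : RawRing c ℓ
  seriesRawRing = record
    { Carrier = Series ; _≈_ = _≋_ ; _+_ = _+ₛ_ ; _*_ = _*ₛ_ ; -_ = -ₛ_ ; 0# = 0ₛ ; 1# = 1ₛ }

-- Polynomials as coefficient lists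

module Polynomial {c ℓ} (R : CommutativeRing c ℓ) where

  open CommutativeRing R
  open RingProperties ring using (-0#≈0#)
  open PowerSeries R
  open NaturalSolver commutativeSemiring using (solve; _:=_; _:+_; _:*_)
  open SetoidReasoning setoid

  Poly : Set c
  Poly = List Carrier

  coeff : Poly → Series
  coeff []      _       = 0#
  coeff (a ∷ f) zero    = a
  coeff (a ∷ f) (suc i) = coeff f i

  infix 4 _≈ₚ_
  -- Lists that differ only by trailing zeros are identified, so no normal form has to be
  -- maintained. The record wrapper lets unification recover `f` and `g`.
  record _≈ₚ_ (f g : Poly) : Set ℓ where
    constructor mk
    field at : coeff f ≋ coeff g
  open _≈ₚ_ public

  eval : Poly → Carrier → Carrier
  eval []      x = 0#
  eval (a ∷ f) x = a + x * eval f x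

  eval-0 : ∀ f x → coeff f ≋ 0ₛ → eval f x ≈ 0#
  eval-0 []      x p = refl
  eval-0 (a ∷ f) x p = begin
    a + x * eval f x ≈⟨ +-cong (p 0) (*-congˡ (eval-0 f x (λ i → p (suc i)))) ⟩
    0# + x * 0#      ≈⟨ trans (+-identityˡ _) (zeroʳ _) ⟩
    0#               ∎

  -- Equal polynomials may be lists of different lengths; the surplus coefficients are zero, and
  -- `eval-0` disposes of them.
  eval-cong : ∀ {f g} x → f ≈ₚ g → eval f x ≈ eval g x
  eval-cong {f} {g} x p = go f g (at p)
    where
    go : ∀ f g → coeff f ≋ coeff g → eval f x ≈ eval g x
    go []      g       p = sym (eval-0 g x (λ i → sym (p i)))
    go (a ∷ f) []      p = eval-0 (a ∷ f) x p
    go (a ∷ f) (b ∷ g) p = +-cong (p 0) (*-congˡ (go f g (λ i → p (suc i))))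

  infixl 6 _⊕_
  infixl 7 _⊛_ _⊙_
  -- Opaque, so that unification can invert these operations.
  opaque
    _⊕_ _⊛_ : Poly → Poly → Poly
    []      ⊕ g       = g
    (a ∷ f) ⊕ []      = a ∷ f
    (a ∷ f) ⊕ (b ∷ g) = a + b ∷ f ⊕ g

    _⊙_ : Carrier → Poly → Poly
    a ⊙ f = map (a *_) f

    []      ⊛ g = []
    (a ∷ f) ⊛ g = a ⊙ g ⊕ (0# ∷ f ⊛ g)

    ⊖_ : Poly → Poly
    ⊖ f = map -_ f

    coeff-⊕ : ∀ f g → coeff (f ⊕ g) ≋ coeff f +ₛ coeff g
    coeff-⊕ []      g       i       = sym (+-identityˡ _)
    coeff-⊕ (a ∷ f) []      i       = sym (+-identityʳ _)
    coeff-⊕ (a ∷ f) (b ∷ g) zero    = refl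
    coeff-⊕ (a ∷ f) (b ∷ g) (suc i) = coeff-⊕ f g i

    coeff-⊙ : ∀ a f → coeff (a ⊙ f) ≋ a ·ₛ coeff f
    coeff-⊙ a []      i       = sym (zeroʳ _)
    coeff-⊙ a (b ∷ f) zero    = refl
    coeff-⊙ a (b ∷ f) (suc i) = coeff-⊙ a f i

    coeff-⊖ : ∀ f → coeff (⊖ f) ≋ -ₛ coeff f
    coeff-⊖ []      i       = sym -0#≈0#
    coeff-⊖ (a ∷ f) zero    = refl
    coeff-⊖ (a ∷ f) (suc i) = coeff-⊖ f i

    coeff-⊛ : ∀ f g → coeff (f ⊛ g) ≋ coeff f *ₛ coeff g
    coeff-⊛ []      g i       = sym (*ₛ-zeroˡ (coeff g) i)
    coeff-⊛ (a ∷ f) g zero    = begin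
      coeff (a ⊙ g ⊕ (0# ∷ f ⊛ g)) 0 ≈⟨ coeff-⊕ (a ⊙ g) _ 0 ⟩
      coeff (a ⊙ g) 0 + 0#           ≈⟨ +-identityʳ _ ⟩
      coeff (a ⊙ g) 0                ≈⟨ coeff-⊙ a g 0 ⟩
      a * coeff g 0                  ∎
    coeff-⊛ (a ∷ f) g (suc i) = begin
      coeff (a ⊙ g ⊕ (0# ∷ f ⊛ g)) (suc i)     ≈⟨ coeff-⊕ (a ⊙ g) _ (suc i) ⟩
      coeff (a ⊙ g) (suc i) + coeff (f ⊛ g) i  ≈⟨ +-cong (coeff-⊙ a g (suc i)) (coeff-⊛ f g i) ⟩
      a * coeff g (suc i) + (coeff f *ₛ coeff g) i ∎

    eval-⊕ : ∀ f g x → eval (f ⊕ g) x ≈ eval f x + eval g x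
    eval-⊕ []      g       x = sym (+-identityˡ _)
    eval-⊕ (a ∷ f) []      x = sym (+-identityʳ _)
    eval-⊕ (a ∷ f) (b ∷ g) x = begin
      a + b + x * eval (f ⊕ g) x         ≈⟨ +-congˡ (*-congˡ (eval-⊕ f g x)) ⟩
      a + b + x * (eval f x + eval g x)
        ≈⟨ solve 5 (λ a b x u v → a :+ b :+ x :* (u :+ v) := (a :+ x :* u) :+ (b :+ x :* v))
             refl _ _ _ _ _ ⟩
      (a + x * eval f x) + (b + x * eval g x) ∎

    eval-⊙ : ∀ a f x → eval (a ⊙ f) x ≈ a * eval f x
    eval-⊙ a []      x = sym (zeroʳ _)
    eval-⊙ a (b ∷ f) x = begin
      a * b + x * eval (a ⊙ f) x   ≈⟨ +-congˡ (*-congˡ (eval-⊙ a f x)) ⟩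
      a * b + x * (a * eval f x)
        ≈⟨ solve 4 (λ a b x u → a :* b :+ x :* (a :* u) := a :* (b :+ x :* u)) refl _ _ _ _ ⟩
      a * (b + x * eval f x)       ∎

    eval-⊛ : ∀ f g x → eval (f ⊛ g) x ≈ eval f x * eval g x
    eval-⊛ []      g x = sym (zeroˡ _)
    eval-⊛ (a ∷ f) g x = begin
      eval (a ⊙ g ⊕ (0# ∷ f ⊛ g)) x                 ≈⟨ eval-⊕ (a ⊙ g) _ x ⟩
      eval (a ⊙ g) x + (0# + x * eval (f ⊛ g) x)
        ≈⟨ +-cong (eval-⊙ a g x) (trans (+-identityˡ _) (*-congˡ (eval-⊛ f g x))) ⟩
      a * eval g x + x * (eval f x * eval g x)
        ≈⟨ solve 4 (λ a x u v → a :* v :+ x :* (u :* v) := (a :+ x :* u) :* v) refl _ _ _ _ ⟩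
      (a + x * eval f x) * eval g x ∎

  0ₚ 1ₚ : Poly
  0ₚ = []
  1ₚ = 1# ∷ []

  coeff-1ₚ : coeff 1ₚ ≋ 1ₛ
  coeff-1ₚ zero    = refl
  coeff-1ₚ (suc i) = refl

  polyRawRing : RawRing c ℓ
  polyRawRing = record
    { Carrier = Poly ; _≈_ = _≈ₚ_ ; _+_ = _⊕_ ; _*_ = _⊛_ ; -_ = ⊖_ ; 0# = 0ₚ ; 1# = 1ₚ }

  -- Injectivity is the definition of `_≈ₚ_`, so all ring laws for lists are pulled back from
  -- series, where no lengths have to be compared.
  coeff-isRingMonomorphism : IsRingMonomorphism polyRawRing seriesRawRing coeff
  coeff-isRingMonomorphism = record
    { isRingHomomorphism = record
      { isSemiringHomomorphism = record
        { isNearSemiringHomomorphism = record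
          { +-isMonoidHomomorphism = record
            { isMagmaHomomorphism = record
              { isRelHomomorphism = record { cong = at }
              ; homo = coeff-⊕
              }
            ; ε-homo = λ _ → refl
            }
          ; *-homo = coeff-⊛
          }
        ; 1#-homo = coeff-1ₚ
        }
      ; -‿homo = coeff-⊖
      }
    ; injective = mk
    }

  polyRing : CommutativeRing c ℓ
  polyRing = record
    { isCommutativeRing =
        RingMonomorphism.isCommutativeRing coeff-isRingMonomorphism series-isCommutativeRing }

  eval-1ₚ : ∀ x → eval 1ₚ x ≈ 1#
  eval-1ₚ x = trans (+-congˡ (zeroʳ x)) (+-identityʳ 1#)

-- Degree, division, derivative and roots of polynomials

module PolynomialTheory {c ℓ} (R : CommutativeRing c ℓ) where

  private
    module K = CommutativeRing R
    module KR = SetoidReasoning K.setoid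
  open PowerSeries R using (Series; _≋_; _*ₛ_; *ₛ-zeroˡ; *ₛ-identityˡ; *ₛ-cong)
  open Polynomial R
  open CommutativeRing polyRing
  open SemiringMult K.semiring using (×-congʳ; ×-comm-*) renaming (_×_ to _·_)
  open CommutativeMonoidMult K.+-commutativeMonoid using (×-distrib-+)
  open SemiringExp semiring using (_^_)
  open SemiringExp K.semiring using () renaming (_^_ to _^ᴷ_; ^-congˡ to ^ᴷ-congˡ)
  open RingProperties K.ring using (-0#≈0#)
  open NaturalSolver commutativeSemiring using (solve; _:=_; _:+_; _:*_; con)
  open SetoidReasoning setoid

  -- Degrees.

  record Below (f : Poly) (n : ℕ) : Set ℓ where
    constructor below
    field vanish : ∀ i → n ≤ i → coeff f i K.≈ K.0#
  open Below public

  -- The coefficient `a` may be zero: the degree is exactly `n` only together with a proof that `a`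
  -- is nonzero.
  record Lead (f : Poly) (n : ℕ) (a : K.Carrier) : Set ℓ where
    constructor lead
    field
      bound : Below f (suc n)
      top   : coeff f n K.≈ a
  open Lead public

  below-resp : ∀ {f g n} → f ≈ g → Below f n → Below g n
  below-resp f≈g b = below λ i n≤i → K.trans (K.sym (at f≈g i)) (vanish b i n≤i)

  below-mono : ∀ {f m n} → m ≤ n → Below f m → Below f n
  below-mono m≤n b = below λ i n≤i → vanish b i (ℕ.≤-trans m≤n n≤i)

  below-0 : ∀ {f} → Below f 0 → f ≈ 0#
  below-0 b = mk λ i → vanish b i z≤n

  below-length : ∀ f → Below f (length f)
  below-length f = below (go f)
    where
    go : ∀ f i → length f ≤ i → coeff f i K.≈ K.0#
    go []      i       _         = K.refl
    go (a ∷ f) (suc i) (s≤s l≤i) = go f i l≤i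

  below-+ : ∀ {f g n} → Below f n → Below g n → Below (f + g) n
  below-+ {f} {g} bf bg = below λ i n≤i →
    K.trans (coeff-⊕ f g i) (K.trans (K.+-cong (vanish bf i n≤i) (vanish bg i n≤i)) (K.+-identityˡ _))

  lead-resp : ∀ {f g n a b} → f ≈ g → a K.≈ b → Lead f n a → Lead g n b
  lead-resp {n = n} f≈g a≈b l =
    lead (below-resp f≈g (bound l)) (K.trans (K.sym (at f≈g n)) (K.trans (top l) a≈b))

  lead-+ : ∀ {f g n a b} → Lead f n a → Lead g n b → Lead (f + g) n (a K.+ b)
  lead-+ {f} {g} {n} lf lg = lead (below-+ (bound lf) (bound lg))
    (K.trans (coeff-⊕ f g n) (K.+-cong (top lf) (top lg)))

  below⇒lead-0 : ∀ {f n} → Below f n → Lead f n K.0#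
  below⇒lead-0 {n = n} b = lead (below-mono (ℕ.n≤1+n _) b) (vanish b n ℕ.≤-refl)

  lead-+-below : ∀ {f g n a} → Lead f n a → Below g n → Lead (f + g) n a
  lead-+-below lf bg = lead-resp refl (K.+-identityʳ _) (lead-+ lf (below⇒lead-0 bg))

  below⇒lead : ∀ {f n} → Below f (suc n) → Lead f n (coeff f n)
  below⇒lead b = lead b K.refl

  module _ {f g : Series} where

    *ₛ-constˡ : (∀ i → 1 ≤ i → f i K.≈ K.0#) → ∀ k → (f *ₛ g) k K.≈ f 0 K.* g k
    *ₛ-constˡ bf zero    = K.refl
    *ₛ-constˡ bf (suc k) = K.trans
      (K.+-congˡ (K.trans (*ₛ-cong (λ i → bf (suc i) (s≤s z≤n)) (λ _ → K.refl) k) (*ₛ-zeroˡ g k)))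
      (K.+-identityʳ _)

  -- Induction on `m`: passing to the tail of `f` lowers its degree bound by one, and the term
  -- `f 0 * g (suc k)` split off vanishes because `suc k` exceeds `n`.
  *ₛ-top : ∀ {f g : Series} m n →
           (∀ i → suc m ≤ i → f i K.≈ K.0#) → (∀ i → suc n ≤ i → g i K.≈ K.0#) →
           (∀ k → suc (m ℕ.+ n) ≤ k → (f *ₛ g) k K.≈ K.0#) × (f *ₛ g) (m ℕ.+ n) K.≈ f m K.* g n
  *ₛ-top zero n bf bg =
    (λ k n<k → K.trans (*ₛ-constˡ bf k) (K.trans (K.*-congˡ (bg k n<k)) (K.zeroʳ _)))
    , *ₛ-constˡ bf n
  *ₛ-top {f} {g} (suc m) n bf bg with *ₛ-top m n (λ i m<i → bf (suc i) (s≤s m<i)) bg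
  ... | bfg , tfg =
    (λ { (suc k) (s≤s lt) → drop k (s≤s (ℕ.≤-trans (ℕ.m≤n+m n m) (ℕ.<⇒≤ lt))) (bfg k lt) })
    , drop (m ℕ.+ n) (s≤s (ℕ.m≤n+m n m)) tfg
    where
    drop : ∀ k → suc n ≤ suc k → ∀ {x} →
           ((λ i → f (suc i)) *ₛ g) k K.≈ x → (f *ₛ g) (suc k) K.≈ x
    drop k n≤k e = K.trans
      (K.+-cong (K.trans (K.*-congˡ (bg (suc k) n≤k)) (K.zeroʳ _)) e) (K.+-identityˡ _)

  lead-* : ∀ {f g m n a b} → Lead f m a → Lead g n b → Lead (f * g) (m ℕ.+ n) (a K.* b)
  lead-* {f} {g} {m} {n} lf lg with *ₛ-top m n (vanish (bound lf)) (vanish (bound lg))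
  ... | bfg , tfg = lead
    (below λ i lt → K.trans (coeff-⊛ f g i) (bfg i lt))
    (K.trans (coeff-⊛ f g (m ℕ.+ n)) (K.trans tfg (K.*-cong (top lf) (top lg))))

  below-* : ∀ {f g m n} → Below f (suc m) → Below g (suc n) → Below (f * g) (suc (m ℕ.+ n))
  below-* bf bg = bound (lead-* (below⇒lead bf) (below⇒lead bg))

  lead-unique : ∀ {f n a b} → Lead f n a → Lead f n b → a K.≈ b
  lead-unique la lb = K.trans (K.sym (top la)) (top lb)

  Regular : K.Carrier → Set _
  Regular a = ∀ {b} → a K.* b K.≈ K.0# → b K.≈ K.0#

  -- The bound on `g` starts at `length g` and is lowered one index at a time. While it exceeds `n`,
  -- the top coefficient of `g` times `a` is a vanishing coefficient of the product, and `a` is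
  -- regular.
  below-cancel : ∀ {f g m a} n → Lead f m a → Regular a →
                 Below (f * g) (m ℕ.+ n) → Below g n
  below-cancel {f} {g} {m} n lf reg bfg = go (length g) (below-length g)
    where
    go : ∀ N → Below g N → Below g n
    go zero    b = below-mono z≤n b
    go (suc N) b with n ℕ.≤? N
    ... | no  n≰N = below-mono (ℕ.≰⇒> n≰N) b
    ... | yes n≤N = go N (below λ i N≤i → step i (ℕ.m≤n⇒m<n∨m≡n N≤i))
      where
      gN≈0 : coeff g N K.≈ K.0#
      gN≈0 = reg (K.trans (K.sym (top (lead-* lf (below⇒lead b))))
                          (vanish bfg (m ℕ.+ N) (ℕ.+-monoʳ-≤ m n≤N)))
      step : ∀ i → _ → coeff g i K.≈ K.0#
      step i (inj₁ N<i)     = vanish b i N<i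
      step i (inj₂ ≡.refl) = gN≈0

  regular-1 : Regular K.1#
  regular-1 e = K.trans (K.sym (K.*-identityˡ _)) e

  -- Degree and leading coefficient of a cofactor are read off a product with a monic factor. The
  -- degrees of `F′`, `q` and `E` are found this way.
  lead-cancel : ∀ {f g m b} n → Lead f m K.1# → Lead (f * g) (m ℕ.+ n) b → Lead g n b
  lead-cancel {f} {g} {m} n lf lfg = lead bg
    (K.trans (K.sym (K.*-identityˡ _)) (lead-unique (lead-* lf (below⇒lead bg)) lfg))
    where
    bg : Below g (suc n)
    bg = below-cancel (suc n) lf regular-1
           (≡.subst (Below (f * g)) (≡.sym (ℕ.+-suc m n)) (bound lfg))

  -- Constants, the variable and linear factors.

  C : K.Carrier → Poly
  C a = a ∷ []

  X : Poly
  X = K.0# ∷ K.1# ∷ []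

  C-cong : ∀ {a b} → a K.≈ b → C a ≈ C b
  C-cong a≈b = mk λ { zero → a≈b ; (suc i) → K.refl }

  C-0 : C K.0# ≈ 0#
  C-0 = mk λ { zero → K.refl ; (suc i) → K.refl }

  C-+ : ∀ a b → C (a K.+ b) ≈ C a + C b
  C-+ a b = mk λ
    { zero    → K.sym (coeff-⊕ (C a) (C b) 0)
    ; (suc i) → K.sym (K.trans (coeff-⊕ (C a) (C b) (suc i)) (K.+-identityˡ _)) }

  coeff-C* : ∀ a f i → coeff (C a * f) i K.≈ a K.* coeff f i
  coeff-C* a f i = K.trans (coeff-⊛ (C a) f i) (*ₛ-constˡ (λ { (suc i) _ → K.refl }) i)

  C-* : ∀ a b → C (a K.* b) ≈ C a * C b
  C-* a b = mk λ
    { zero    → K.sym (coeff-C* a (C b) 0)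
    ; (suc i) → K.sym (K.trans (coeff-C* a (C b) (suc i)) (K.zeroʳ _)) }

  lead-C : ∀ a → Lead (C a) 0 a
  lead-C a = lead (below-length (C a)) K.refl

  eval-C : ∀ a x → eval (C a) x K.≈ a
  eval-C a x = K.trans (K.+-congˡ (K.zeroʳ x)) (K.+-identityʳ a)

  shift : ∀ f → K.0# ∷ f ≈ X * f
  shift f = mk λ
    { zero    → K.sym (K.trans (coeff-⊛ X f 0) (K.zeroˡ _))
    ; (suc i) → K.sym (K.trans (coeff-⊛ X f (suc i))
        (K.trans (K.+-cong (K.zeroˡ _)
          (K.trans (*ₛ-cong coeff-1ₚ (λ _ → K.refl) i) (*ₛ-identityˡ (coeff f) i)))
        (K.+-identityˡ _))) }

  -- Translates the list constructor into ring operations, so that inductions on lists can be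
  -- finished by the ring solver.
  uncons : ∀ a f → a ∷ f ≈ C a + X * f
  uncons a f = trans (mk λ
    { zero    → K.sym (K.trans (coeff-⊕ (C a) (K.0# ∷ f) 0) (K.+-identityʳ a))
    ; (suc i) → K.sym (K.trans (coeff-⊕ (C a) (K.0# ∷ f) (suc i)) (K.+-identityˡ _)) })
    (+-congˡ (shift f))

  lin : K.Carrier → Poly
  lin x = K.- x ∷ K.1# ∷ []

  lead-lin : ∀ x → Lead (lin x) 1 K.1#
  lead-lin x = lead (below-length (lin x)) K.refl

  eval-lin : ∀ x y → eval (lin x) y K.≈ K.- x K.+ y
  eval-lin x y = K.+-congˡ (K.trans (K.*-congˡ (eval-1ₚ y)) (K.*-identityʳ y))

  lin-root : ∀ x → eval (lin x) x K.≈ K.0#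
  lin-root x = K.trans (eval-lin x x) (K.-‿inverseˡ x)

  lin-root⁻ : ∀ x y → eval (lin x) y K.≈ K.0# → x K.≈ y
  lin-root⁻ x y e = KR.begin
    x                      KR.≈⟨ K.+-identityʳ x ⟨
    x K.+ K.0#             KR.≈⟨ K.+-congˡ (K.trans (K.sym e) (eval-lin x y)) ⟩
    x K.+ (K.- x K.+ y)    KR.≈⟨ K.+-assoc _ _ _ ⟨
    x K.+ K.- x K.+ y      KR.≈⟨ K.trans (K.+-congʳ (K.-‿inverseʳ x)) (K.+-identityˡ y) ⟩
    y                      KR.∎

  X≈lin : ∀ x → X ≈ lin x + C x
  X≈lin x = mk λ
    { zero          → K.sym (K.trans (coeff-⊕ (lin x) (C x) 0) (K.-‿inverseˡ x))
    ; (suc zero)    → K.sym (K.trans (coeff-⊕ (lin x) (C x) 1) (K.+-identityʳ _))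
    ; (suc (suc i)) → K.sym (K.trans (coeff-⊕ (lin x) (C x) (suc (suc i))) (K.+-identityʳ _)) }

  -- Synthetic division: the coefficients of the quotient by `lin x` are the Horner values of the
  -- successive tails.
  quot : Poly → K.Carrier → Poly
  quot []      x = []
  quot (a ∷ f) x = eval f x ∷ quot f x

  division : ∀ f x → f ≈ C (eval f x) + lin x * quot f x
  division []      x = sym (trans (+-cong C-0 (zeroʳ (lin x))) (+-identityˡ 0#))
  division (a ∷ f) x = begin
    a ∷ f                         ≈⟨ uncons a f ⟩
    C a + X * f                   ≈⟨ +-congˡ (*-congˡ (division f x)) ⟩
    C a + X * (C e + lin x * g)
      ≈⟨ solve 5 (λ a z e l g → a :+ z :* (e :+ l :* g) := a :+ z :* e :+ l :* (z :* g))
           refl _ _ _ _ _ ⟩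
    C a + X * C e + lin x * (X * g)           ≈⟨ +-congʳ (+-congˡ (*-congʳ (X≈lin x))) ⟩
    C a + (lin x + C x) * C e + lin x * (X * g)
      ≈⟨ solve 5 (λ a l x e m → a :+ (l :+ x) :* e :+ l :* m := (a :+ x :* e) :+ l :* (e :+ m))
           refl _ _ _ _ _ ⟩
    C a + C x * C e + lin x * (C e + X * g)
      ≈⟨ +-cong (trans (C-+ a (x K.* e)) (+-congˡ (C-* x e))) (*-congˡ (uncons e g)) ⟨
    C (a K.+ x K.* e) + lin x * (e ∷ g) ∎
    where
    e = eval f x
    g = quot f x

  -- The formal derivative.

  deriv : Poly → Poly
  deriv []      = []
  deriv (a ∷ f) = f + (K.0# ∷ deriv f)

  ·-zeroʳ : ∀ n → n · K.0# K.≈ K.0#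
  ·-zeroʳ zero    = K.refl
  ·-zeroʳ (suc n) = K.trans (K.+-identityˡ _) (·-zeroʳ n)

  -- `deriv` is the product rule for `a + X f`, and each step of its recursion adds one more copy of
  -- the coefficient. Congruence and additivity follow from this formula.
  coeff-deriv : ∀ f i → coeff (deriv f) i K.≈ suc i · coeff f (suc i)
  coeff-deriv []      i       = K.sym (·-zeroʳ (suc i))
  coeff-deriv (a ∷ f) zero    = coeff-⊕ f _ 0
  coeff-deriv (a ∷ f) (suc i) =
    K.trans (coeff-⊕ f _ (suc i)) (K.+-congˡ (coeff-deriv f i))

  deriv-cong : ∀ {f g} → f ≈ g → deriv f ≈ deriv g
  deriv-cong {f} {g} f≈g = mk λ i → K.trans (coeff-deriv f i)
    (K.trans (×-congʳ (suc i) (at f≈g (suc i))) (K.sym (coeff-deriv g i)))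

  deriv-+ : ∀ f g → deriv (f + g) ≈ deriv f + deriv g
  deriv-+ f g = mk λ i → KR.begin
    coeff (deriv (f + g)) i                                KR.≈⟨ coeff-deriv (f + g) i ⟩
    suc i · coeff (f + g) (suc i)                          KR.≈⟨ ×-congʳ (suc i) (coeff-⊕ f g (suc i)) ⟩
    suc i · (coeff f (suc i) K.+ coeff g (suc i))          KR.≈⟨ ×-distrib-+ _ _ (suc i) ⟩
    suc i · coeff f (suc i) K.+ suc i · coeff g (suc i)    KR.≈⟨ K.+-cong (coeff-deriv f i) (coeff-deriv g i) ⟨
    coeff (deriv f) i K.+ coeff (deriv g) i                KR.≈⟨ coeff-⊕ (deriv f) (deriv g) i ⟨
    coeff (deriv f + deriv g) i                            KR.∎

  deriv-C* : ∀ a f → deriv (C a * f) ≈ C a * deriv f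
  deriv-C* a f = mk λ i → KR.begin
    coeff (deriv (C a * f)) i             KR.≈⟨ coeff-deriv (C a * f) i ⟩
    suc i · coeff (C a * f) (suc i)       KR.≈⟨ ×-congʳ (suc i) (coeff-C* a f (suc i)) ⟩
    suc i · (a K.* coeff f (suc i))       KR.≈⟨ ×-comm-* (suc i) a _ ⟨
    a K.* (suc i · coeff f (suc i))       KR.≈⟨ K.*-congˡ (coeff-deriv f i) ⟨
    a K.* coeff (deriv f) i               KR.≈⟨ coeff-C* a (deriv f) i ⟨
    coeff (C a * deriv f) i               KR.∎

  deriv-X* : ∀ f → deriv (X * f) ≈ f + X * deriv f
  deriv-X* f = trans (deriv-cong (sym (shift f))) (+-congˡ (shift (deriv f)))

  -- Induction on the first factor, written as `C a + X * f`; this leaves only products with a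
  -- constant and with `X`.
  deriv-* : ∀ f g → deriv (f * g) ≈ deriv f * g + f * deriv g
  deriv-* []      g = begin
    deriv (0# * g)           ≈⟨ deriv-cong (zeroˡ g) ⟩
    0#                       ≈⟨ +-identityˡ 0# ⟨
    0# + 0#                  ≈⟨ +-cong (zeroˡ g) (zeroˡ (deriv g)) ⟨
    0# * g + 0# * deriv g    ∎
  deriv-* (a ∷ f) g = begin
    deriv ((a ∷ f) * g)
      ≈⟨ deriv-cong (trans (*-congʳ (uncons a f))
           (solve 4 (λ a x f g → (a :+ x :* f) :* g := a :* g :+ x :* (f :* g)) refl _ _ _ _)) ⟩
    deriv (C a * g + X * (f * g))
      ≈⟨ trans (deriv-+ (C a * g) (X * (f * g))) (+-cong (deriv-C* a g) (deriv-X* (f * g))) ⟩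
    C a * deriv g + (f * g + X * deriv (f * g))
      ≈⟨ +-congˡ (+-congˡ (*-congˡ (deriv-* f g))) ⟩
    C a * deriv g + (f * g + X * (deriv f * g + f * deriv g))
      ≈⟨ solve 6 (λ a x f g f′ g′ → a :* g′ :+ (f :* g :+ x :* (f′ :* g :+ f :* g′))
                    := (f :+ x :* f′) :* g :+ (a :+ x :* f) :* g′) refl _ _ _ _ _ _ ⟩
    (f + X * deriv f) * g + (C a + X * f) * deriv g
      ≈⟨ +-cong (*-congʳ (+-congˡ (shift (deriv f)))) (*-congʳ (uncons a f)) ⟨
    deriv (a ∷ f) * g + (a ∷ f) * deriv g ∎

  deriv-C : ∀ a → deriv (C a) ≈ 0#
  deriv-C a = trans (+-identityˡ _) C-0

  deriv-lin : ∀ x → deriv (lin x) ≈ 1#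
  deriv-lin x = trans
    (+-congˡ (trans (shift (deriv 1#)) (trans (*-congˡ (deriv-C K.1#)) (zeroʳ X))))
    (+-identityʳ 1#)

  below-deriv : ∀ {f n} → Below f (suc n) → Below (deriv f) n
  below-deriv {f} b = below λ i n≤i → K.trans (coeff-deriv f i)
    (K.trans (×-congʳ (suc i) (vanish b (suc i) (s≤s n≤i))) (·-zeroʳ (suc i)))

  -- The extra factor `lin x` gives both sides the exponent `n`, so the power with exponent `n - 1`
  -- is avoided at `n = 0`.
  deriv-lin^ : ∀ x n → lin x * deriv (lin x ^ n) ≈ C (n · K.1#) * lin x ^ n
  deriv-lin^ x zero    = begin
    lin x * deriv 1#  ≈⟨ trans (*-congˡ (deriv-C K.1#)) (zeroʳ _) ⟩
    0#                ≈⟨ trans (*-congʳ C-0) (zeroˡ _) ⟨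
    C K.0# * 1#       ∎
  deriv-lin^ x (suc n) = begin
    l * deriv (l * l ^ n)                     ≈⟨ *-congˡ (deriv-* l (l ^ n)) ⟩
    l * (deriv l * l ^ n + l * deriv (l ^ n))
      ≈⟨ *-congˡ (+-cong (*-congʳ (deriv-lin x)) (deriv-lin^ x n)) ⟩
    l * (1# * l ^ n + C (n · K.1#) * l ^ n)
      ≈⟨ solve 3 (λ l m k → l :* (con 1 :* m :+ k :* m) := (con 1 :+ k) :* (l :* m)) refl _ _ _ ⟩
    (1# + C (n · K.1#)) * (l * l ^ n)         ≈⟨ *-congʳ (C-+ K.1# (n · K.1#)) ⟨
    C (suc n · K.1#) * (l * l ^ n)            ∎
    where l = lin x

  -- Products of linear factors.

  ∏lin : List K.Carrier → Poly
  ∏lin []       = 1#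
  ∏lin (x ∷ xs) = lin x * ∏lin xs

  lead-∏lin : ∀ xs → Lead (∏lin xs) (length xs) K.1#
  lead-∏lin []       = lead-C K.1#
  lead-∏lin (x ∷ xs) = lead-resp refl (K.*-identityˡ _) (lead-* (lead-lin x) (lead-∏lin xs))

  eval-*-0ˡ : ∀ f g x → eval f x K.≈ K.0# → eval (f * g) x K.≈ K.0#
  eval-*-0ˡ f g x e = K.trans (eval-⊛ f g x) (K.trans (K.*-congʳ e) (K.zeroˡ _))

  eval-*-0ʳ : ∀ f g x → eval g x K.≈ K.0# → eval (f * g) x K.≈ K.0#
  eval-*-0ʳ f g x e = K.trans (eval-⊛ f g x) (K.trans (K.*-congˡ e) (K.zeroʳ _))

  eval-+-0 : ∀ f g x → eval f x K.≈ K.0# → eval g x K.≈ K.0# → eval (f + g) x K.≈ K.0#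
  eval-+-0 f g x e e′ = K.trans (eval-⊕ f g x) (K.trans (K.+-cong e e′) (K.+-identityˡ _))

  ∏lin-root : ∀ {x xs} → x ∈ xs → eval (∏lin xs) x K.≈ K.0#
  ∏lin-root {x} {_ ∷ xs} (here ≡.refl) = eval-*-0ˡ (lin x) _ x (lin-root x)
  ∏lin-root {x} {y ∷ xs} (there x∈xs)  = eval-*-0ʳ (lin y) _ x (∏lin-root x∈xs)

  eval-lin^ : ∀ x y n → eval (lin x ^ n) y K.≈ (K.- x K.+ y) ^ᴷ n
  eval-lin^ x y zero    = eval-1ₚ y
  eval-lin^ x y (suc n) = K.trans (eval-⊛ (lin x) (lin x ^ n) y) (K.*-cong (eval-lin x y) (eval-lin^ x y n))

  eval-lin0^ : ∀ y n → eval (lin K.0# ^ n) y K.≈ y ^ᴷ n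
  eval-lin0^ y n = K.trans (eval-lin^ K.0# y n)
    (^ᴷ-congˡ n (K.trans (K.+-congʳ -0#≈0#) (K.+-identityˡ y)))

  lead-lin^ : ∀ x n → Lead (lin x ^ n) n K.1#
  lead-lin^ x zero    = lead-C K.1#
  lead-lin^ x (suc n) = lead-resp refl (K.*-identityˡ _) (lead-* (lead-lin x) (lead-lin^ x n))

  module _ (pt : ℕ → K.Carrier) (w : ℕ → ℕ) where

    ∏lin^ : List ℕ → Poly
    ∏lin^ []       = 1#
    ∏lin^ (x ∷ xs) = lin (pt x) ^ w x * ∏lin^ xs

    -- The sum over `x` of `w x` times the product of the linear factors of all other points: the
    -- logarithmic derivative of `∏lin^`, multiplied by the common denominator `∏lin`.
    logDeriv : List ℕ → Poly
    logDeriv []       = 0#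
    logDeriv (x ∷ xs) = lin (pt x) * logDeriv xs + C (w x · K.1#) * ∏lin (map pt xs)

    lead-∏lin^ : ∀ xs → Lead (∏lin^ xs) (sum (map w xs)) K.1#
    lead-∏lin^ []       = lead-C K.1#
    lead-∏lin^ (x ∷ xs) =
      lead-resp refl (K.*-identityˡ _) (lead-* (lead-lin^ (pt x) (w x)) (lead-∏lin^ xs))

    below-logDeriv : ∀ xs → Below (logDeriv xs) (length xs)
    below-logDeriv []       = below-length 0#
    below-logDeriv (x ∷ xs) = below-+
      (below-lin* xs (below-logDeriv xs))
      (≡.subst (λ n → Below (C (w x · K.1#) * ∏lin (map pt xs)) (suc n)) (length-map pt xs)
        (bound (lead-* (lead-C (w x · K.1#)) (lead-∏lin (map pt xs)))))
      where
      below-lin* : ∀ xs {g} → Below g (length xs) → Below (lin (pt x) * g) (suc (length xs))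
      below-lin* []       b = below-mono z≤n
        (below-resp (sym (trans (*-congˡ (below-0 b)) (zeroʳ _))) (below-length 0#))
      below-lin* (_ ∷ xs) b = below-* (bound (lead-lin (pt x))) b

    logDeriv-spec : ∀ xs →
      ∏lin (map pt xs) * deriv (∏lin^ xs) ≈ logDeriv xs * ∏lin^ xs
    logDeriv-spec []       = trans (*-congˡ (deriv-C K.1#)) (trans (zeroʳ _) (sym (zeroˡ _)))
    logDeriv-spec (x ∷ xs) = begin
      l * D * deriv (L * F)
        ≈⟨ *-congˡ (deriv-* L F) ⟩
      l * D * (deriv L * F + L * deriv F)
        ≈⟨ solve 6 (λ l D L′ F L F′ → l :* D :* (L′ :* F :+ L :* F′)
              := (l :* L′) :* (D :* F) :+ l :* L :* (D :* F′)) refl _ _ _ _ _ _ ⟩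
      l * deriv L * (D * F) + l * L * (D * deriv F)
        ≈⟨ +-cong (*-congʳ (deriv-lin^ (pt x) (w x))) (*-congˡ (logDeriv-spec xs)) ⟩
      C (w x · K.1#) * L * (D * F) + l * L * (logDeriv xs * F)
        ≈⟨ solve 6 (λ k L D F l G → k :* L :* (D :* F) :+ l :* L :* (G :* F)
              := (l :* G :+ k :* D) :* (L :* F)) refl _ _ _ _ _ _ ⟩
      logDeriv (x ∷ xs) * ∏lin^ (x ∷ xs) ∎
      where
      l = lin (pt x)
      L = lin (pt x) ^ w x
      D = ∏lin (map pt xs)
      F = ∏lin^ xs

    -- As in Lagrange interpolation, terms vanish at the points of the list: at the head point the
    -- linear factor kills the first summand, at a later point the product over the tail kills the
    -- second. The product rule for `∏lin` leaves matching terms.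
    eval-logDeriv : ∀ {y} xs → y ∈ xs →
      eval (logDeriv xs) (pt y) K.≈ (w y · K.1#) K.* eval (deriv (∏lin (map pt xs))) (pt y)
    eval-logDeriv {y} (x ∷ xs) y∈ = KR.begin
      eval (l * G + C wx * D) (pt y)
        KR.≈⟨ K.trans (eval-⊕ (l * G) (C wx * D) (pt y)) (K.+-cong (eval-⊛ l G (pt y))
               (K.trans (eval-⊛ (C wx) D (pt y)) (K.*-congʳ (eval-C wx (pt y))))) ⟩
      eval l (pt y) K.* eval G (pt y) K.+ wx K.* eval D (pt y)
        KR.≈⟨ cases y∈ ⟩
      (w y · K.1#) K.* (eval D (pt y) K.+ eval l (pt y) K.* eval (deriv D) (pt y))
        KR.≈⟨ K.*-congˡ (K.+-cong (K.trans (K.*-congʳ (eval-1ₚ (pt y))) (K.*-identityˡ _)) K.refl) ⟨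
      (w y · K.1#) K.* (eval 1# (pt y) K.* eval D (pt y) K.+ eval l (pt y) K.* eval (deriv D) (pt y))
        KR.≈⟨ K.*-congˡ (K.+-cong (eval-⊛ 1# D (pt y)) (eval-⊛ l (deriv D) (pt y))) ⟨
      (w y · K.1#) K.* (eval (1# * D) (pt y) K.+ eval (l * deriv D) (pt y))
        KR.≈⟨ K.*-congˡ (eval-⊕ (1# * D) (l * deriv D) (pt y)) ⟨
      (w y · K.1#) K.* eval (1# * D + l * deriv D) (pt y)
        KR.≈⟨ K.*-congˡ (eval-cong (pt y) (trans (deriv-* l D) (+-congʳ (*-congʳ (deriv-lin (pt x)))))) ⟨
      (w y · K.1#) K.* eval (deriv (l * D)) (pt y) KR.∎
      where
      l  = lin (pt x)
      G  = logDeriv xs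
      D  = ∏lin (map pt xs)
      wx = w x · K.1#
      cases : y ∈ x ∷ xs → eval l (pt y) K.* eval G (pt y) K.+ wx K.* eval D (pt y)
              K.≈ (w y · K.1#) K.* (eval D (pt y) K.+ eval l (pt y) K.* eval (deriv D) (pt y))
      cases (here ≡.refl) = KR.begin
        eval l (pt y) K.* eval G (pt y) K.+ wx K.* eval D (pt y)
          KR.≈⟨ K.trans (K.+-congʳ (K.trans (K.*-congʳ (lin-root (pt y))) (K.zeroˡ _))) (K.+-identityˡ _) ⟩
        wx K.* eval D (pt y)
          KR.≈⟨ K.*-congˡ (K.trans (K.+-congˡ (K.trans (K.*-congʳ (lin-root (pt y))) (K.zeroˡ _))) (K.+-identityʳ _)) ⟨
        wx K.* (eval D (pt y) K.+ eval l (pt y) K.* eval (deriv D) (pt y)) KR.∎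
      cases (there y∈xs) = KR.begin
        eval l (pt y) K.* eval G (pt y) K.+ wx K.* eval D (pt y)
          KR.≈⟨ K.+-cong (K.*-congˡ (eval-logDeriv xs y∈xs)) (K.*-congˡ D≈0) ⟩
        eval l (pt y) K.* ((w y · K.1#) K.* eval (deriv D) (pt y)) K.+ wx K.* K.0#
          KR.≈⟨ K.trans (K.+-congˡ (K.zeroʳ _)) (K.+-identityʳ _) ⟩
        eval l (pt y) K.* ((w y · K.1#) K.* eval (deriv D) (pt y))
          KR.≈⟨ K.trans (K.sym (K.*-assoc _ _ _)) (K.trans (K.*-congʳ (K.*-comm _ _)) (K.*-assoc _ _ _)) ⟩
        (w y · K.1#) K.* (eval l (pt y) K.* eval (deriv D) (pt y))
          KR.≈⟨ K.*-congˡ (K.trans (K.+-congʳ D≈0) (K.+-identityˡ _)) ⟨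
        (w y · K.1#) K.* (eval D (pt y) K.+ eval l (pt y) K.* eval (deriv D) (pt y)) KR.∎
        where
        D≈0 = ∏lin-root (∈-map⁺ pt y∈xs)

    lin^-root : ∀ x n → eval (lin x ^ suc n) x K.≈ K.0#
    lin^-root x n = eval-*-0ˡ (lin x) (lin x ^ n) x (lin-root x)

    deriv-lin^-root : ∀ x n → eval (deriv (lin x ^ suc (suc n))) x K.≈ K.0#
    deriv-lin^-root x n = K.trans (eval-cong x (deriv-* l (l ^ suc n)))
      (eval-+-0 (deriv l * l ^ suc n) _ x
        (eval-*-0ʳ (deriv l) (l ^ suc n) x (lin^-root x n)) (eval-*-0ˡ l _ x (lin-root x)))
      where l = lin x

    ∏lin^-root : ∀ {y n} xs → y ∈ xs → w y ≡ suc n → eval (∏lin^ xs) (pt y) K.≈ K.0#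
    ∏lin^-root {y} {n} (_ ∷ xs) (here ≡.refl) wy = eval-*-0ˡ (lin (pt y) ^ w y) (∏lin^ xs) (pt y)
      (≡.subst (λ m → eval (lin (pt y) ^ m) (pt y) K.≈ K.0#) (≡.sym wy) (lin^-root (pt y) n))
    ∏lin^-root {y} (x ∷ xs) (there y∈) wy =
      eval-*-0ʳ (lin (pt x) ^ w x) (∏lin^ xs) (pt y) (∏lin^-root xs y∈ wy)

    -- An exponent of at least two makes the point a double root, so both summands of the product
    -- rule vanish there.
    deriv-∏lin^-root : ∀ {y n} xs → y ∈ xs → w y ≡ suc (suc n) →
                       eval (deriv (∏lin^ xs)) (pt y) K.≈ K.0#
    deriv-∏lin^-root {y} {n} (x ∷ xs) y∈ wy =
      K.trans (eval-cong (pt y) (deriv-* L F)) (cases y∈)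
      where
      L = lin (pt x) ^ w x
      F = ∏lin^ xs
      cases : y ∈ x ∷ xs → eval (deriv L * F + L * deriv F) (pt y) K.≈ K.0#
      cases (here ≡.refl) = eval-+-0 (deriv L * F) (L * deriv F) (pt y)
        (eval-*-0ˡ (deriv L) F (pt y)
          (≡.subst (λ m → eval (deriv (lin (pt y) ^ m)) (pt y) K.≈ K.0#) (≡.sym wy)
            (deriv-lin^-root (pt y) n)))
        (eval-*-0ˡ L (deriv F) (pt y)
          (≡.subst (λ m → eval (lin (pt y) ^ m) (pt y) K.≈ K.0#) (≡.sym wy)
            (lin^-root (pt y) (suc n))))
      cases (there y∈xs) = eval-+-0 (deriv L * F) (L * deriv F) (pt y)
        (eval-*-0ʳ (deriv L) F (pt y) (∏lin^-root xs y∈xs wy))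
        (eval-*-0ʳ L (deriv F) (pt y) (deriv-∏lin^-root xs y∈xs wy))

  -- Roots over an integral domain.

  module Domain (regular : ∀ {a} → ¬ a K.≈ K.0# → Regular a) where

    Distinct : List K.Carrier → Set _
    Distinct = AllPairs (λ x y → ¬ x K.≈ y)

    Root : Poly → K.Carrier → Set _
    Root f x = eval f x K.≈ K.0#

    factor : ∀ f {x} → Root f x → f ≈ lin x * quot f x
    factor f {x} r =
      trans (division f x) (trans (+-congʳ (trans (C-cong r) C-0)) (+-identityˡ _))

    -- Roots are divided off one by one. The other roots remain roots of the quotient because their
    -- differences from `x` are nonzero, hence regular.
    ∏lin-divides : ∀ f {xs} → Distinct xs → All (Root f) xs → ∃ λ g → f ≈ ∏lin xs * g
    ∏lin-divides f []                   []       = f , sym (*-identityˡ f)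
    ∏lin-divides f {x ∷ xs} (x∉ ∷ dist) (r ∷ rs)
      with ∏lin-divides (quot f x) dist (All.zipWith root (x∉ , rs))
      where
      root : ∀ {y} → (¬ x K.≈ y) × Root f y → Root (quot f x) y
      root {y} (x≉y , e) = regular (λ l≈0 → x≉y (lin-root⁻ x y l≈0))
        (K.trans (K.sym (eval-⊛ (lin x) (quot f x) y))
          (K.trans (K.sym (eval-cong y (factor f r))) e))
    ... | g , q≈ = g , (begin
      f                          ≈⟨ factor f r ⟩
      lin x * quot f x           ≈⟨ *-congˡ q≈ ⟩
      lin x * (∏lin xs * g)      ≈⟨ *-assoc _ _ _ ⟨
      lin x * ∏lin xs * g        ∎)

    -- The product of the linear factors is monic of degree `length xs`, so a cofactor in a
    -- polynomial of smaller degree must be zero.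
    roots⇒0 : ∀ {f xs} → Distinct xs → All (Root f) xs → Below f (length xs) → f ≈ 0#
    roots⇒0 {f} {xs} dist rs b with ∏lin-divides f dist rs
    ... | g , f≈ = trans f≈ (trans (*-congˡ (below-0 b₀)) (zeroʳ _))
      where
      b₀ : Below g 0
      b₀ = below-cancel 0 (lead-∏lin xs) regular-1
             (below-mono (ℕ.m≤m+n (length xs) 0) (below-resp f≈ b))

    roots-≤-degree : ∀ {f n a xs} → Lead f n a → ¬ a K.≈ K.0# →
                     Distinct xs → All (Root f) xs → length xs ≤ n
    roots-≤-degree {f} {n} {a} {xs} l a≉0 dist rs with length xs ℕ.≤? n
    ... | yes p = p
    ... | no ¬p = ⊥-elim (a≉0 (K.trans (K.sym (top l))
                    (at (roots⇒0 dist rs (below-mono (ℕ.≰⇒> ¬p) (bound l))) n)))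

-- Counting the points with value at least 2

module _ (w : ℕ → ℕ) where

  multiplicity : ℕ → List ℕ → ℕ
  multiplicity v xs = length (filter (λ x → w x ℕ.≟ v) xs)

  large : List ℕ → List ℕ
  large = filter (λ x → 2 ℕ.≤? w x)

  private
    open ℕSolver.+-*-Solver

    -- The right-hand side of the counting inequality: `s` is the sum of the values, and `a`, `b`,
    -- `c`, `e` are the multiplicities of 0, 2, 3 and 4.
    weighted : ℕ → ℕ → ℕ → ℕ → ℕ → ℕ
    weighted s a b c e = s ℕ.+ (a ℕ.+ 3 ℕ.* b ℕ.+ 2 ℕ.* c ℕ.+ e)

    -- A new point with a large value raises the left side by 4 + 1, so it suffices that the right
    -- side grows by at least 5.
    step : ∀ k l {r r′} → 4 ℕ.* k ℕ.+ l ≤ r → 5 ℕ.+ r ≤ r′ → 4 ℕ.* suc k ℕ.+ suc l ≤ r′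
    step k l {r} {r′} ih le = begin
      4 ℕ.* suc k ℕ.+ suc l     ≡⟨ solve 2 (λ k l → con 4 :* (con 1 :+ k) :+ (con 1 :+ l)
                                     := con 5 :+ (con 4 :* k :+ l)) ≡.refl k l ⟩
      5 ℕ.+ (4 ℕ.* k ℕ.+ l)     ≤⟨ ℕ.+-monoʳ-≤ 5 ih ⟩
      5 ℕ.+ r                   ≤⟨ le ⟩
      r′                        ∎
      where open ℕ.≤-Reasoning

    weighted-2 : ∀ s a b c e → 5 ℕ.+ weighted s a b c e ≡ weighted (2 ℕ.+ s) a (suc b) c e
    weighted-2 = solve 5 (λ s a b c e → con 5 :+ (s :+ (a :+ con 3 :* b :+ con 2 :* c :+ e))
      := con 2 :+ s :+ (a :+ con 3 :* (con 1 :+ b) :+ con 2 :* c :+ e)) ≡.refl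

    weighted-3 : ∀ s a b c e → 5 ℕ.+ weighted s a b c e ≡ weighted (3 ℕ.+ s) a b (suc c) e
    weighted-3 = solve 5 (λ s a b c e → con 5 :+ (s :+ (a :+ con 3 :* b :+ con 2 :* c :+ e))
      := con 3 :+ s :+ (a :+ con 3 :* b :+ con 2 :* (con 1 :+ c) :+ e)) ≡.refl

    weighted-4 : ∀ s a b c e → 5 ℕ.+ weighted s a b c e ≡ weighted (4 ℕ.+ s) a b c (suc e)
    weighted-4 = solve 5 (λ s a b c e → con 5 :+ (s :+ (a :+ con 3 :* b :+ con 2 :* c :+ e))
      := con 4 :+ s :+ (a :+ con 3 :* b :+ con 2 :* c :+ (con 1 :+ e))) ≡.refl

  -- Pointwise, 4 [w ≥ 2] + 1 ≤ w + [w = 0] + 3 [w = 2] + 2 [w = 3] + [w = 4].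
  4*large≤ : ∀ xs → 4 ℕ.* length (large xs) ℕ.+ length xs ≤
    weighted (sum (map w xs)) (multiplicity 0 xs) (multiplicity 2 xs) (multiplicity 3 xs) (multiplicity 4 xs)
  4*large≤ []       = z≤n
  4*large≤ (x ∷ xs) with 4*large≤ xs | w x
  ... | ih | 0 = ℕ.≤-trans (ℕ.≤-reflexive (ℕ.+-suc (4 ℕ.* length (large xs)) _))
                   (ℕ.≤-trans (s≤s ih) (ℕ.≤-reflexive (≡.sym (ℕ.+-suc (sum (map w xs)) _))))
  ... | ih | 1 = ℕ.≤-trans (ℕ.≤-reflexive (ℕ.+-suc (4 ℕ.* length (large xs)) _)) (s≤s ih)
  ... | ih | 2 = step (length (large xs)) (length xs) ih (ℕ.≤-reflexive (weighted-2 (sum (map w xs))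
        (multiplicity 0 xs) (multiplicity 2 xs) (multiplicity 3 xs) (multiplicity 4 xs)))
  ... | ih | 3 = step (length (large xs)) (length xs) ih (ℕ.≤-reflexive (weighted-3 (sum (map w xs))
        (multiplicity 0 xs) (multiplicity 2 xs) (multiplicity 3 xs) (multiplicity 4 xs)))
  ... | ih | 4 = step (length (large xs)) (length xs) ih (ℕ.≤-reflexive (weighted-4 (sum (map w xs))
        (multiplicity 0 xs) (multiplicity 2 xs) (multiplicity 3 xs) (multiplicity 4 xs)))
  -- From 5 on, the value itself covers the increase of 5, without help from the multiplicities.
  ... | ih | suc (suc (suc (suc (suc v)))) = step (length (large xs)) (length xs) ih
        (ℕ.+-monoʳ-≤ 5 (ℕ.+-monoˡ-≤ _ (ℕ.m≤n+m (sum (map w xs)) v)))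

  -- The multiplicity bounds give `4 k ≤ d + 3 * 2 + 2 * 2 + 2 = d + 12`. If `d ≤ 2 k + 2`, doubling
  -- yields `2 d ≤ 4 k + 4 ≤ d + 16`, against `16 < d`.
  large-bound : ∀ xs d → sum (map w xs) ≡ length xs → 16 < d →
    multiplicity 0 xs ≤ d → (∀ v → 2 ≤ v → multiplicity v xs ≤ 2) →
    suc (suc (length (large xs)) ℕ.+ suc (length (large xs))) ≤ d
  large-bound xs d sum≡ 16<d m₀ m with d ℕ.≤? suc k ℕ.+ suc k
    where k = length (large xs)
  ... | no ¬p = ℕ.≰⇒> ¬p
  ... | yes d≤ = ⊥-elim (ℕ.<⇒≱ 16<d (ℕ.+-cancelˡ-≤ d d 16 (begin
    d ℕ.+ d                           ≤⟨ ℕ.+-mono-≤ d≤ d≤ ⟩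
    (suc k ℕ.+ suc k) ℕ.+ (suc k ℕ.+ suc k)
      ≡⟨ solve 1 (λ k → (con 1 :+ k :+ (con 1 :+ k)) :+ (con 1 :+ k :+ (con 1 :+ k))
                    := con 4 :* k :+ con 4) ≡.refl k ⟩
    4 ℕ.* k ℕ.+ 4                     ≤⟨ ℕ.+-monoˡ-≤ 4 4k≤ ⟩
    d ℕ.+ 12 ℕ.+ 4                    ≡⟨ ℕ.+-assoc d 12 4 ⟩
    d ℕ.+ 16                          ∎)))
    where
    open ℕ.≤-Reasoning
    k = length (large xs)
    4k≤ : 4 ℕ.* k ≤ d ℕ.+ 12
    4k≤ = ℕ.+-cancelʳ-≤ (length xs) _ _ (begin
      4 ℕ.* k ℕ.+ length xs      ≤⟨ 4*large≤ xs ⟩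
      sum (map w xs) ℕ.+ _       ≤⟨ ℕ.+-mono-≤ (ℕ.≤-reflexive sum≡)
        (ℕ.+-mono-≤ (ℕ.+-mono-≤ (ℕ.+-mono-≤ m₀ (ℕ.*-monoʳ-≤ 3 (m 2 ℕ.≤-refl)))
          (ℕ.*-monoʳ-≤ 2 (m 3 (s≤s (s≤s z≤n))))) (m 4 (s≤s (s≤s z≤n)))) ⟩
      length xs ℕ.+ (d ℕ.+ 6 ℕ.+ 4 ℕ.+ 2)
        ≡⟨ solve 2 (λ l d → l :+ (d :+ con 6 :+ con 4 :+ con 2) := d :+ con 12 :+ l) ≡.refl (length xs) d ⟩
      d ℕ.+ 12 ℕ.+ length xs     ∎)

-- Polynomials over an integral domain of prime characteristic

module PrimeCharacteristic {r ℓ} (R : CommutativeRing r ℓ) where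

  private
    module K = CommutativeRing R
    module KR = SetoidReasoning K.setoid
    module KSolver = NaturalSolver K.commutativeSemiring
  open Polynomial R
  open PolynomialTheory R
  open CommutativeRing polyRing
  open RingProperties K.ring using (-1*x≈-x; -‿involutive; -0#≈0#; +-cancelˡ)
  open SemiringMult K.semiring using (×-congʳ; ×-homo-+; ×-assoc-*) renaming (_×_ to _·_)
  open SemiringExp semiring using (_^_)
  open SemiringExp K.semiring using () renaming (_^_ to _^ᴷ_; ^-congˡ to ^ᴷ-congˡ)
  open NaturalSolver commutativeSemiring using (solve; _:=_; _:+_; _:*_; con)
  open SetoidReasoning setoid

  ι : ℕ → K.Carrier
  ι n = n · K.1#

  -- An integral domain of characteristic `p`, described without division; the prime field is
  -- present as the values of `ι`.
  module _ (regular : ∀ {a} → ¬ a K.≈ K.0# → Regular a)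
           (p : ℕ) (1<p : 1 < p) (char : ι p K.≈ K.0#)
           (unit : ∀ {n} → 0 < n → n < p → ¬ ι n K.≈ K.0#) where

    open Domain regular

    1≉0 : ¬ K.1# K.≈ K.0#
    1≉0 e = unit (s≤s z≤n) 1<p (K.trans (K.+-identityʳ _) e)

    -1≉0 : ¬ K.- K.1# K.≈ K.0#
    -1≉0 e = 1≉0 (K.trans (K.sym (-‿involutive K.1#)) (K.trans (K.-‿cong e) -0#≈0#))

    ι-injective : ∀ {x y} → x < y → y < p → ¬ ι x K.≈ ι y
    ι-injective {x} {y} x<y y<p e = unit (ℕ.m<n⇒0<n∸m x<y) (ℕ.≤-<-trans (ℕ.m∸n≤m y x) y<p)
      (K.sym (+-cancelˡ (ι x) _ _ (KR.begin
        ι x K.+ K.0#          KR.≈⟨ K.trans (K.+-identityʳ _) e ⟩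
        ι y                   KR.≡⟨ ≡.cong ι (ℕ.m+[n∸m]≡n (ℕ.<⇒≤ x<y)) ⟨
        ι (x ℕ.+ (y ℕ.∸ x))   KR.≈⟨ ×-homo-+ K.1# x (y ℕ.∸ x) ⟩
        ι x K.+ ι (y ℕ.∸ x)   KR.∎)))

    distinct : ∀ {xs} → Unique xs → (∀ {x} → x ∈ xs → x < p) → Distinct (map ι xs)
    distinct []            <p = []
    distinct {x ∷ xs} (x∉ ∷ uniq) <p =
      All.map⁺ (All.tabulate λ y∈ → separate (All.lookup x∉ y∈) (<p (there y∈)))
      ∷ distinct uniq (λ y∈ → <p (there y∈))
      where
      separate : ∀ {y} → ¬ x ≡ y → y < p → ¬ ι x K.≈ ι y
      separate {y} x≢y y<p e with ℕ.<-cmp x y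
      ... | tri< x<y _ _ = ι-injective x<y y<p e
      ... | tri≈ _ x≡y _ = x≢y x≡y
      ... | tri> _ _ y<x = ι-injective y<x (<p (here ≡.refl)) (K.sym e)

    -- The factor `suc i` in the derivative is regular below `p`, so only the constant term and the
    -- indices from `p` on escape.
    deriv-0⇒coeff-0 : ∀ f i → suc i < p → coeff (deriv f) i K.≈ K.0# → coeff f (suc i) K.≈ K.0#
    deriv-0⇒coeff-0 f i i<p e = regular (unit (s≤s z≤n) i<p) (KR.begin
      ι (suc i) K.* coeff f (suc i)          KR.≈⟨ ×-assoc-* (suc i) K.1# _ ⟩
      suc i · (K.1# K.* coeff f (suc i))     KR.≈⟨ ×-congʳ (suc i) (K.*-identityˡ _) ⟩
      suc i · coeff f (suc i)                KR.≈⟨ coeff-deriv f i ⟨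
      coeff (deriv f) i                      KR.≈⟨ e ⟩
      K.0#                                   KR.∎)

    -- After multiplication by `lin x` the derivative acquires the factor `ι p`, which is zero; the
    -- monic `lin x` then cancels.
    deriv-lin^p : ∀ x → deriv (lin x ^ p) ≈ 0#
    deriv-lin^p x = below-0 (below-cancel 0 (lead-lin x) regular-1 (below-resp
      (sym (trans (deriv-lin^ x p) (trans (*-congʳ (trans (C-cong char) C-0)) (zeroˡ _))))
      (below-mono z≤n (below-length 0#))))

    -- A polynomial of degree p with zero derivative only involves X^p and 1.
    lin^p-affine : ∀ x → ∃ λ e → lin x ^ p ≈ lin K.0# ^ p + C e
    lin^p-affine x = e , mk λ i → K.trans (go i (ℕ.<-cmp i p)) (K.sym (coeff-⊕ B (C e) i))
      where
      A = lin x ^ p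
      B = lin K.0# ^ p
      e = coeff A 0 K.+ K.- coeff B 0
      lA = lead-lin^ x p
      lB = lead-lin^ K.0# p
      both0 : ∀ {a b : K.Carrier} → a K.≈ K.0# → b K.≈ K.0# → a K.≈ b K.+ K.0#
      both0 ea eb = K.trans ea (K.sym (K.trans (K.+-identityʳ _) eb))
      go : ∀ i → Tri (i < p) (i ≡ p) (p < i) → coeff A i K.≈ coeff B i K.+ coeff (C e) i
      go zero    _ = K.sym (KR.begin
        coeff B 0 K.+ (coeff A 0 K.+ K.- coeff B 0)  KR.≈⟨ K.+-comm _ _ ⟩
        coeff A 0 K.+ K.- coeff B 0 K.+ coeff B 0    KR.≈⟨ K.+-assoc _ _ _ ⟩
        coeff A 0 K.+ (K.- coeff B 0 K.+ coeff B 0)  KR.≈⟨ K.trans (K.+-congˡ (K.-‿inverseˡ _)) (K.+-identityʳ _) ⟩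
        coeff A 0                                    KR.∎)
      go (suc i) (tri< i<p _ _)    = both0
        (deriv-0⇒coeff-0 A i i<p (at (deriv-lin^p x) i))
        (deriv-0⇒coeff-0 B i i<p (at (deriv-lin^p K.0#) i))
      go (suc i) (tri≈ _ ≡.refl _) = K.trans (top lA) (K.sym (K.trans (K.+-identityʳ _) (top lB)))
      go (suc i) (tri> _ _ p<i)    = both0 (vanish (bound lA) _ p<i) (vanish (bound lB) _ p<i)

    1^≈1 : ∀ n → K.1# ^ᴷ n K.≈ K.1#
    1^≈1 zero    = K.refl
    1^≈1 (suc n) = K.trans (K.*-identityˡ _) (1^≈1 n)

    0^p≈0 : K.0# ^ᴷ p K.≈ K.0#
    0^p≈0 = go 1<p
      where
      go : ∀ {n} → 1 < n → K.0# ^ᴷ n K.≈ K.0#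
      go (s≤s _) = K.zeroˡ _

    -- Frobenius without binomial coefficients: the p-th powers of X + 1 and X differ by a constant,
    -- and evaluation at 0 shows that it is 1.
    [1+y]^p : ∀ y → (K.1# K.+ y) ^ᴷ p K.≈ K.1# K.+ y ^ᴷ p
    [1+y]^p y with lin^p-affine (K.- K.1#)
    ... | e , eq = K.trans (formula y) (K.trans (K.+-comm _ _) (K.+-congʳ e≈1))
      where
      formula : ∀ y → (K.1# K.+ y) ^ᴷ p K.≈ y ^ᴷ p K.+ e
      formula y = KR.begin
        (K.1# K.+ y) ^ᴷ p                            KR.≈⟨ ^ᴷ-congˡ p (K.+-congʳ (-‿involutive K.1#)) ⟨
        (K.- K.- K.1# K.+ y) ^ᴷ p                    KR.≈⟨ eval-lin^ (K.- K.1#) y p ⟨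
        eval (lin (K.- K.1#) ^ p) y                  KR.≈⟨ eval-cong y eq ⟩
        eval (lin K.0# ^ p + C e) y                  KR.≈⟨ eval-⊕ (lin K.0# ^ p) (C e) y ⟩
        eval (lin K.0# ^ p) y K.+ eval (C e) y       KR.≈⟨ K.+-cong (eval-lin0^ y p) (eval-C e y) ⟩
        y ^ᴷ p K.+ e                                 KR.∎
      e≈1 : e K.≈ K.1#
      e≈1 = KR.begin
        e                           KR.≈⟨ K.trans (K.+-congʳ 0^p≈0) (K.+-identityˡ e) ⟨
        K.0# ^ᴷ p K.+ e             KR.≈⟨ formula K.0# ⟨
        (K.1# K.+ K.0#) ^ᴷ p        KR.≈⟨ ^ᴷ-congˡ p (K.+-identityʳ K.1#) ⟩
        K.1# ^ᴷ p                   KR.≈⟨ 1^≈1 p ⟩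
        K.1#                        KR.∎

    fermat : ∀ x → ι x ^ᴷ p K.≈ ι x
    fermat zero    = 0^p≈0
    fermat (suc x) = K.trans ([1+y]^p (ι x)) (K.+-congˡ (fermat x))

    -- The product over all points is X^p - X

    points : List ℕ
    points = upTo p

    distinct-points : Distinct (map ι points)
    distinct-points = distinct (upTo⁺ p) ∈-upTo⁻

    length-points : length (map ι points) ≡ p
    length-points = ≡.trans (length-map ι points) (length-upTo p)

    D : Poly
    D = ∏lin (map ι points)

    lead-D : Lead D p K.1#
    lead-D = ≡.subst (λ n → Lead D n K.1#) length-points (lead-∏lin (map ι points))

    on-points : ∀ f → (∀ x → x ∈ points → Root f (ι x)) → All (Root f) (map ι points)
    on-points f r = All.map⁺ (All.tabulate λ {x} x∈ → r x x∈)

    -- Subtraction is written as adding a multiple of this constant, which keeps the identities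
    -- within reach of the semiring solver; `-1ₚ+1` supplies the cancellations.
    -1ₚ : Poly
    -1ₚ = C (K.- K.1#)

    -1ₚ+1 : -1ₚ + 1# ≈ 0#
    -1ₚ+1 = trans (sym (C-+ (K.- K.1#) K.1#)) (trans (C-cong (K.-‿inverseˡ K.1#)) C-0)

    X^p-X : Poly
    X^p-X = lin K.0# ^ p + (K.0# ∷ -1ₚ)

    X^p-X-root : ∀ x → Root X^p-X (ι x)
    X^p-X-root x = KR.begin
      eval X^p-X (ι x)
        KR.≈⟨ eval-⊕ (lin K.0# ^ p) (K.0# ∷ -1ₚ) (ι x) ⟩
      eval (lin K.0# ^ p) (ι x) K.+ (K.0# K.+ ι x K.* eval -1ₚ (ι x))
        KR.≈⟨ K.+-cong (K.trans (eval-lin0^ (ι x) p) (fermat x))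
             (K.trans (K.+-identityˡ _) (K.trans (K.*-congˡ (eval-C _ (ι x)))
               (K.trans (K.*-comm _ _) (-1*x≈-x (ι x))))) ⟩
      ι x K.+ K.- ι x
        KR.≈⟨ K.-‿inverseʳ (ι x) ⟩
      K.0# KR.∎

    -- By Fermat all `p` points are roots, so `D` divides X^p - X; both are monic of degree `p`,
    -- which forces the cofactor 1.
    X^p-X≈D : X^p-X ≈ D
    X^p-X≈D with ∏lin-divides X^p-X distinct-points (on-points X^p-X λ x _ → X^p-X-root x)
    ... | g , U≈Dg = trans U≈Dg (trans (*-congˡ g≈1) (*-identityʳ D))
      where
      lg : Lead g 0 K.1#
      lg = lead-cancel 0 lead-D (≡.subst (λ n → Lead (D * g) n K.1#) (≡.sym (ℕ.+-identityʳ p))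
             (lead-resp U≈Dg K.refl
               (lead-+-below (lead-lin^ K.0# p) (below-mono 1<p (below-length (K.0# ∷ -1ₚ))))))
      g≈1 : g ≈ 1#
      g≈1 = mk λ { zero → top lg ; (suc i) → vanish (bound lg) (suc i) (s≤s z≤n) }

    deriv-D : deriv D ≈ -1ₚ
    deriv-D = begin
      deriv D                                      ≈⟨ deriv-cong X^p-X≈D ⟨
      deriv X^p-X                                  ≈⟨ deriv-+ (lin K.0# ^ p) (K.0# ∷ -1ₚ) ⟩
      deriv (lin K.0# ^ p) + (-1ₚ + (K.0# ∷ deriv -1ₚ))
        ≈⟨ +-cong (deriv-lin^p K.0#)
             (+-congˡ (trans (shift (deriv -1ₚ)) (trans (*-congˡ (deriv-C (K.- K.1#))) (zeroʳ X)))) ⟩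
      0# + (-1ₚ + 0#)                              ≈⟨ trans (+-identityˡ _) (+-identityʳ _) ⟩
      -1ₚ                                          ∎

    x+y≈0⇒x≈-1*y : ∀ {x y} → x + y ≈ 0# → x ≈ -1ₚ * y
    x+y≈0⇒x≈-1*y {x} {y} e = begin
      x                        ≈⟨ +-identityʳ x ⟨
      x + 0#                   ≈⟨ +-congˡ (trans (*-congʳ -1ₚ+1) (zeroˡ y)) ⟨
      x + (-1ₚ + 1#) * y       ≈⟨ solve 3 (λ x c y → x :+ (c :+ con 1) :* y := (x :+ y) :+ c :* y) refl _ _ _ ⟩
      (x + y) + -1ₚ * y        ≈⟨ trans (+-congʳ e) (+-identityˡ _) ⟩
      -1ₚ * y                  ∎

    *-nonzero : ∀ {a b} → ¬ a K.≈ K.0# → ¬ b K.≈ K.0# → ¬ a K.* b K.≈ K.0#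
    *-nonzero a≉0 b≉0 e = b≉0 (regular a≉0 e)

    -- A hypothetical polynomial with range sum p

    module _ {f : Poly} {d : ℕ} {a : K.Carrier} (lead-f : Lead f d a) (a≉0 : ¬ a K.≈ K.0#)
             (d+d≡1+p : d ℕ.+ d ≡ suc p) (16<d : 16 < d)
             (w : ℕ → ℕ) (f≈w : ∀ x → x < p → eval f (ι x) K.≈ ι (w x))
             (sum≡p : sum (map w points) ≡ p) where

      d<p : d < p
      d<p = ℕ.s≤s⁻¹ (≡.subst (2 ℕ.+ d ≤_) d+d≡1+p (ℕ.+-monoˡ-≤ d (ℕ.≤-trans (s≤s (s≤s z≤n)) 16<d)))

      F F′ : Poly
      F  = ∏lin^ ι w points
      F′ = deriv F

      lead-F : Lead F p K.1#
      lead-F = ≡.subst (λ n → Lead F n K.1#) sum≡p (lead-∏lin^ ι w points)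

      -- Lagrange interpolation of f at all points of the field.
      logDeriv+f≈0 : logDeriv ι w points + f ≈ 0#
      logDeriv+f≈0 = roots⇒0 distinct-points (on-points (logDeriv ι w points + f) root)
        (≡.subst (Below _) (≡.sym length-points)
          (below-+ (≡.subst (Below _) (length-upTo p) (below-logDeriv ι w points))
                   (below-mono d<p (bound lead-f))))
        where
        root : ∀ x → x ∈ points → Root (logDeriv ι w points + f) (ι x)
        root x x∈ = KR.begin
          eval (logDeriv ι w points + f) (ι x)
            KR.≈⟨ eval-⊕ (logDeriv ι w points) f (ι x) ⟩
          eval (logDeriv ι w points) (ι x) K.+ eval f (ι x)
            KR.≈⟨ K.+-cong (eval-logDeriv ι w points x∈) (f≈w x (∈-upTo⁻ x∈)) ⟩
          ι (w x) K.* eval (deriv D) (ι x) K.+ ι (w x)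
            KR.≈⟨ K.+-congʳ (K.*-congˡ (K.trans (eval-cong (ι x) deriv-D) (eval-C _ (ι x)))) ⟩
          ι (w x) K.* K.- K.1# K.+ ι (w x)
            KR.≈⟨ K.+-congʳ (K.trans (K.*-comm _ _) (-1*x≈-x _)) ⟩
          K.- ι (w x) K.+ ι (w x)
            KR.≈⟨ K.-‿inverseˡ _ ⟩
          K.0# KR.∎

      -- The interpolation identity turns the logarithmic derivative of `F` into a differential
      -- equation, from which the degrees of `F′`, `V` and `q` are obtained.
      D*F′+f*F≈0 : D * F′ + f * F ≈ 0#
      D*F′+f*F≈0 = begin
        D * F′ + f * F                          ≈⟨ +-congʳ (logDeriv-spec ι w points) ⟩
        logDeriv ι w points * F + f * F         ≈⟨ distribʳ F _ f ⟨
        (logDeriv ι w points + f) * F           ≈⟨ trans (*-congʳ logDeriv+f≈0) (zeroˡ F) ⟩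
        0#                                      ∎

      -- The leading coefficient of `-1ₚ * (f * F)`, left in the unreduced form that `lead-*`
      -- returns; `s` and `t` below are formed likewise.
      b : K.Carrier
      b = K.- K.1# K.* (a K.* K.1#)

      b≉0 : ¬ b K.≈ K.0#
      b≉0 = *-nonzero -1≉0 (*-nonzero a≉0 1≉0)

      -- Degree count in `D * F′ = - f * F`: the right side has degree `d + p`, and the monic `D` of
      -- degree `p` cancels.
      lead-F′ : Lead F′ d b
      lead-F′ = lead-cancel d lead-D (lead-resp (sym (x+y≈0⇒x≈-1*y D*F′+f*F≈0)) K.refl
        (≡.subst (λ n → Lead (-1ₚ * (f * F)) n b) (ℕ.+-comm d p)
          (lead-* (lead-C (K.- K.1#)) (lead-* lead-f lead-F))))

      V : Poly
      V = F + -1ₚ * D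

      F≈D+V : F ≈ D + V
      F≈D+V = begin
        F                        ≈⟨ +-identityʳ F ⟨
        F + 0#                   ≈⟨ +-congˡ (trans (*-congʳ -1ₚ+1) (zeroˡ D)) ⟨
        F + (-1ₚ + 1#) * D
          ≈⟨ solve 3 (λ F c D → F :+ (c :+ con 1) :* D := D :+ (F :+ c :* D)) refl _ _ _ ⟩
        D + (F + -1ₚ * D)        ∎

      -- As `D` has derivative -1, `deriv V` is `F′` plus a constant, which does not reach the
      -- positive degree `d`.
      lead-V′ : Lead (deriv V) d b
      lead-V′ = lead-resp (sym eq) K.refl (lead-+-below lead-F′
        (below-mono (ℕ.≤-trans (s≤s z≤n) 16<d) (below-* (below-length -1ₚ) (below-length -1ₚ))))
        where
        eq : deriv V ≈ F′ + -1ₚ * -1ₚ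
        eq = trans (deriv-+ F (-1ₚ * D)) (+-congˡ (trans (deriv-C* _ D) (*-congˡ deriv-D)))

      -- At index `p` the two leading ones cancel, and beyond it both polynomials vanish. Between
      -- `d + 2` and `p - 1` the coefficients are recovered from the derivative, which has degree
      -- `d`.
      below-V : Below V (suc (suc d))
      below-V = below go
        where
        vp : ∀ i → p ≤ i → coeff V i K.≈ K.0#
        vp i p≤i with ℕ.m≤n⇒m<n∨m≡n p≤i
        ... | inj₁ p<i     = vanish (bound (lead-+ lead-F (lead-* (lead-C (K.- K.1#)) lead-D))) i p<i
        ... | inj₂ ≡.refl = K.trans (top (lead-+ lead-F (lead-* (lead-C (K.- K.1#)) lead-D)))
                (K.trans (K.+-congˡ (K.*-identityʳ _)) (K.-‿inverseʳ K.1#))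
        go : ∀ i → suc (suc d) ≤ i → coeff V i K.≈ K.0#
        go (suc i) (s≤s d<i) with p ℕ.≤? suc i
        ... | yes p≤i = vp (suc i) p≤i
        ... | no  p≰i = deriv-0⇒coeff-0 V i (ℕ.≰⇒> p≰i) (vanish (bound lead-V′) i d<i)

      e : K.Carrier
      e = coeff V (suc d)

      -- Otherwise `V` would have degree at most `d` and its derivative degree below `d`, but the
      -- coefficient `b` there is nonzero.
      e≉0 : ¬ e K.≈ K.0#
      e≉0 e≈0 = b≉0 (K.trans (K.sym (top lead-V′))
        (vanish (below-deriv {V} (below vd)) d ℕ.≤-refl))
        where
        vd : ∀ i → suc d ≤ i → coeff V i K.≈ K.0#
        vd i d<i with ℕ.m≤n⇒m<n∨m≡n d<i
        ... | inj₁ lt      = vanish below-V i lt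
        ... | inj₂ ≡.refl = e≈0

      q : Poly
      q = F′ + f

      F*q≈V*F′ : F * q ≈ V * F′
      F*q≈V*F′ = begin
        F * (F′ + f)                       ≈⟨ distribˡ F F′ f ⟩
        F * F′ + F * f                     ≈⟨ +-congʳ (*-congʳ F≈D+V) ⟩
        (D + V) * F′ + F * f
          ≈⟨ solve 5 (λ D V F′ F f → (D :+ V) :* F′ :+ F :* f := (D :* F′ :+ f :* F) :+ V :* F′)
               refl _ _ _ _ _ ⟩
        (D * F′ + f * F) + V * F′          ≈⟨ trans (+-congʳ D*F′+f*F≈0) (+-identityˡ _) ⟩
        V * F′                             ∎

      -- Degree count in `F * q = V * F′`: since `(d + 1) + d = p + 2`, cancelling the monic `F` of
      -- degree `p` leaves 2.
      lead-q : Lead q 2 (e K.* b)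
      lead-q = lead-cancel 2 lead-F (lead-resp (sym F*q≈V*F′) K.refl
        (≡.subst (λ n → Lead (V * F′) n (e K.* b))
          (≡.trans (≡.cong suc d+d≡1+p) (ℕ.+-comm 2 p))
          (lead-* (lead below-V K.refl) lead-F′)))

      filter-roots : ∀ {P : ℕ → Set} (P? : Decidable P) {g n a} → Lead g n a → ¬ a K.≈ K.0# →
                     (∀ x → x ∈ points → P x → Root g (ι x)) → length (filter P? points) ≤ n
      filter-roots P? {g} {n} lg a≉0 roots = ≡.subst (_≤ n) (length-map ι (filter P? points))
        (roots-≤-degree lg a≉0
          (distinct (filter⁺ P? (upTo⁺ p)) (λ x∈ → ∈-upTo⁻ (proj₁ (∈-filter⁻ P? x∈))))
          (All.map⁺ (All.tabulate λ {x} x∈ →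
            roots x (proj₁ (∈-filter⁻ P? x∈)) (proj₂ (∈-filter⁻ P? {xs = points} x∈)))))

      multiplicity-0≤d : multiplicity w 0 points ≤ d
      multiplicity-0≤d = filter-roots (λ x → w x ℕ.≟ 0) lead-f a≉0 λ x x∈ wx≡0 →
        K.trans (f≈w x (∈-upTo⁻ x∈)) (K.reflexive (≡.cong ι wx≡0))

      -- The points counted are roots of the quadratic `q - v`: there `F′` vanishes by the double
      -- root and `f` takes the value `v`.
      multiplicity≤2 : ∀ v → 2 ≤ v → multiplicity w v points ≤ 2
      multiplicity≤2 (suc (suc v)) (s≤s (s≤s z≤n)) = filter-roots (λ x → w x ℕ.≟ suc (suc v))
        (lead-+-below lead-q (below-mono (s≤s z≤n) (below-length (C (K.- ι (suc (suc v)))))))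
        (*-nonzero e≉0 b≉0) λ x x∈ wx≡ → KR.begin
          eval (q + C (K.- ι (suc (suc v)))) (ι x)
            KR.≈⟨ K.trans (eval-⊕ q _ (ι x)) (K.+-cong (eval-⊕ F′ f (ι x)) (eval-C _ (ι x))) ⟩
          eval F′ (ι x) K.+ eval f (ι x) K.+ K.- ι (suc (suc v))
            KR.≈⟨ K.+-congʳ (K.+-cong (deriv-∏lin^-root ι w points x∈ wx≡)
                 (K.trans (f≈w x (∈-upTo⁻ x∈)) (K.reflexive (≡.cong ι wx≡)))) ⟩
          K.0# K.+ ι (suc (suc v)) K.+ K.- ι (suc (suc v))
            KR.≈⟨ K.trans (K.+-congʳ (K.+-identityˡ _)) (K.-‿inverseʳ _) ⟩
          K.0# KR.∎

      -- Elimination from f (f - 1) P = D E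

      k : ℕ
      k = length (large w points)

      2k+3≤d : suc (suc k ℕ.+ suc k) ≤ d
      2k+3≤d = large-bound w points d (≡.trans sum≡p (≡.sym (length-upTo p))) 16<d
                 multiplicity-0≤d multiplicity≤2

      -- `f₁` is 2 f - 1. The derivative of `h` is `f′ * f₁` and the square of `f₁` is 4 h + 1; the
      -- elimination rests on these two facts.
      P P′ f′ f̂ f₁ h : Poly
      P  = ∏lin (map ι (large w points))
      P′ = deriv P
      f′ = deriv f
      f̂  = f + -1ₚ
      f₁ = f + f̂
      h  = f * f̂

      f≈f̂+1 : f ≈ f̂ + 1#
      f≈f̂+1 = sym (trans (+-assoc f -1ₚ 1#) (trans (+-congˡ -1ₚ+1) (+-identityʳ f)))

      lead-f̂ : Lead f̂ d a
      lead-f̂ = lead-+-below lead-f (below-mono (ℕ.≤-trans (s≤s z≤n) 16<d) (below-length -1ₚ))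

      lead-P : Lead P k K.1#
      lead-P = ≡.subst (λ n → Lead P n K.1#) (length-map ι (large w points)) (lead-∏lin (map ι (large w points)))

      h*P-root : ∀ x → x ∈ points → Root (h * P) (ι x)
      h*P-root x x∈ = go (w x) ≡.refl
        where
        value : ∀ {v} → w x ≡ v → eval f (ι x) K.≈ ι v
        value eq = K.trans (f≈w x (∈-upTo⁻ x∈)) (K.reflexive (≡.cong ι eq))
        go : ∀ v → w x ≡ v → Root (h * P) (ι x)
        go 0 eq = eval-*-0ˡ h P (ι x) (eval-*-0ˡ f f̂ (ι x) (value eq))
        go 1 eq = eval-*-0ˡ h P (ι x) (eval-*-0ʳ f f̂ (ι x)
          (K.trans (eval-⊕ f -1ₚ (ι x)) (K.trans
            (K.+-cong (K.trans (value eq) (K.+-identityʳ _)) (eval-C _ (ι x)))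
            (K.-‿inverseʳ K.1#))))
        go (suc (suc v)) eq = eval-*-0ʳ h P (ι x) (∏lin-root (∈-map⁺ ι
          (∈-filter⁺ (λ x → 2 ℕ.≤? w x) x∈ (≡.subst (2 ≤_) (≡.sym eq) (s≤s (s≤s z≤n))))))

      module _ {E : Poly} (h*P≈D*E : h * P ≈ D * E) where

        s : K.Carrier
        s = a K.* a K.* K.1#

        s≉0 : ¬ s K.≈ K.0#
        s≉0 = *-nonzero (*-nonzero a≉0 a≉0) 1≉0

        -- The product `h * P` has degree `2 d + k = p + (k + 1)`, and the monic `D` accounts for
        -- `p` of it.
        lead-E : Lead E (suc k) s
        lead-E = lead-cancel (suc k) lead-D (lead-resp h*P≈D*E K.refl
          (≡.subst (λ n → Lead (h * P) n s)
            (≡.trans (≡.cong (ℕ._+ k) d+d≡1+p) (≡.sym (ℕ.+-suc p k)))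
            (lead-* (lead-* lead-f lead-f̂) lead-P)))

        -- `T` is -4 E² + E P′ - E′ P, and `W` is its explicit cofactor with respect to `f₁`. `four`
        -- is associated like the solver's `con 4`, so that the two agree definitionally.
        E′ four T W : Poly
        E′   = deriv E
        four = 1# + 1# + 1# + 1#
        T    = four * -1ₚ * (E * E) + E * P′ + -1ₚ * (E′ * P)
        W    = four * E * f′ * P + f₁ * E * P′ + -1ₚ * (E′ * P * f₁)

        h′P+hP′ : f′ * f₁ * P + h * P′ ≈ -1ₚ * E + D * E′
        h′P+hP′ = begin
          f′ * f₁ * P + h * P′
            ≈⟨ +-congʳ (*-congʳ (solve 3 (λ f′ f u → f′ :* (f :+ u) := f′ :* u :+ f :* f′) refl f′ f f̂)) ⟩
          (f′ * f̂ + f * f′) * P + h * P′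
            ≈⟨ +-congʳ (*-congʳ (trans (deriv-* f f̂) (+-congˡ (*-congˡ f̂′≈f′)))) ⟨
          deriv h * P + h * P′          ≈⟨ deriv-* h P ⟨
          deriv (h * P)                 ≈⟨ deriv-cong h*P≈D*E ⟩
          deriv (D * E)                 ≈⟨ deriv-* D E ⟩
          deriv D * E + D * E′          ≈⟨ +-congʳ (*-congʳ deriv-D) ⟩
          -1ₚ * E + D * E′              ∎
          where
          f̂′≈f′ : deriv f̂ ≈ f′
          f̂′≈f′ = trans (deriv-+ f -1ₚ) (trans (+-congˡ (deriv-C (K.- K.1#))) (+-identityʳ f′))

        -- Writing `f` as `f̂ + 1#` turns this into an identity in the single variable `f̂`.
        f₁² : f₁ * f₁ ≈ four * h + 1#
        f₁² = begin
          (f + f̂) * (f + f̂)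
            ≈⟨ *-cong (+-congʳ f≈f̂+1) (+-congʳ f≈f̂+1) ⟩
          (f̂ + 1# + f̂) * (f̂ + 1# + f̂)
            ≈⟨ solve 1 (λ u → (u :+ con 1 :+ u) :* (u :+ con 1 :+ u)
                  := con 4 :* ((u :+ con 1) :* u) :+ con 1) refl f̂ ⟩
          four * ((f̂ + 1#) * f̂) + 1#
            ≈⟨ +-congʳ (*-congˡ (*-congʳ f≈f̂+1)) ⟨
          four * h + 1# ∎

        -- Multiply the differentiated relation `h′P+hP′` by 4 E, replace `D * E` by `h * P`, and
        -- then 4 h by `f₁ * f₁` minus 1. All terms with `f₁` collect on one side. The calculation
        -- runs this backwards, from `f₁ * W`.
        f₁*W≈T : f₁ * W ≈ T
        f₁*W≈T = begin
          f₁ * (four * E * f′ * P + f₁ * E * P′ + c * (E′ * P * f₁))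
            ≈⟨ solve 8 (λ g k E f′ P P′ c E′ →
                 g :* (k :* E :* f′ :* P :+ g :* E :* P′ :+ c :* (E′ :* P :* g))
                 := k :* E :* (f′ :* g :* P) :+ (g :* g) :* (E :* P′) :+ (g :* g) :* (c :* (E′ :* P)))
                 refl f₁ four E f′ P P′ c E′ ⟩
          four * E * (f′ * f₁ * P) + f₁ * f₁ * (E * P′) + f₁ * f₁ * (c * (E′ * P))
            ≈⟨ +-cong (+-congˡ (*-congʳ f₁²)) (*-congʳ f₁²) ⟩
          four * E * (f′ * f₁ * P) + (four * h + 1#) * (E * P′) + (four * h + 1#) * (c * (E′ * P))
            ≈⟨ solve 8 (λ k E A h P P′ c E′ →
                 k :* E :* A :+ (k :* h :+ con 1) :* (E :* P′) :+ (k :* h :+ con 1) :* (c :* (E′ :* P))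
                 := k :* E :* (A :+ h :* P′) :+ E :* P′ :+ k :* c :* E′ :* (h :* P) :+ c :* (E′ :* P))
                 refl four E (f′ * f₁ * P) h P P′ c E′ ⟩
          four * E * (f′ * f₁ * P + h * P′) + E * P′ + four * c * E′ * (h * P) + c * (E′ * P)
            ≈⟨ +-congʳ (+-cong (+-congʳ (*-congˡ h′P+hP′)) (*-congˡ h*P≈D*E)) ⟩
          four * E * (c * E + D * E′) + E * P′ + four * c * E′ * (D * E) + c * (E′ * P)
            ≈⟨ solve 7 (λ k E c D E′ P P′ →
                 k :* E :* (c :* E :+ D :* E′) :+ E :* P′ :+ k :* c :* E′ :* (D :* E) :+ c :* (E′ :* P)
                 := (k :* c :* (E :* E) :+ E :* P′ :+ c :* (E′ :* P)) :+ (c :+ con 1) :* (k :* E :* D :* E′))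
                 refl four E c D E′ P P′ ⟩
          -- The term 4 E D E′ arises twice with opposite signs, once from differentiating `D * E`
          -- and once from `h * P = D * E`.
          T + (c + 1#) * (four * E * D * E′)
            ≈⟨ trans (+-congˡ (trans (*-congʳ -1ₚ+1) (zeroˡ _))) (+-identityʳ T) ⟩
          T ∎
          where c = -1ₚ

        4ᴷ t : K.Carrier
        4ᴷ = K.1# K.+ K.1# K.+ K.1# K.+ K.1#
        t  = 4ᴷ K.* K.- K.1# K.* (s K.* s)

        -- Only the square of `E` reaches degree 2 k + 2; in each of the other two terms a
        -- derivative lowers one factor and `P` has only degree `k`.
        lead-T : Lead T (suc k ℕ.+ suc k) t
        lead-T = lead-+-below (lead-+-below
          (lead-* (lead-* (lead-+ (lead-+ (lead-+ l1 l1) l1) l1) (lead-C (K.- K.1#))) (lead-* lead-E lead-E))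
          (≡.subst (Below (E * P′)) (≡.sym (≡.cong suc (ℕ.+-suc k k)))
            -- `below-*` takes bounds of successor form, so the bound `k` on `P′` is relaxed to
            -- `k + 1`; the product still stays below index 2 k + 2.
            (below-* (bound lead-E) (below-mono (ℕ.n≤1+n k) (below-deriv (bound lead-P))))))
          (below-mono (s≤s (ℕ.+-monoʳ-≤ k (ℕ.n≤1+n k)))
            (below-* (below-length -1ₚ) (below-* (below-deriv (bound lead-E)) (bound lead-P))))
          where
          l1 = lead-C K.1#

        2≉0 : ¬ K.1# K.+ K.1# K.≈ K.0#
        2≉0 eq = unit (s≤s z≤n) (ℕ.≤-trans (ℕ.≤-trans (s≤s (s≤s (s≤s z≤n))) 16<d) (ℕ.<⇒≤ d<p))
          (K.trans (K.+-congˡ (K.+-identityʳ K.1#)) eq)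

        t≉0 : ¬ t K.≈ K.0#
        t≉0 = *-nonzero (*-nonzero 4≉0 -1≉0) (*-nonzero s≉0 s≉0)
          where
          4≉0 : ¬ 4ᴷ K.≈ K.0#
          4≉0 eq = *-nonzero 2≉0 2≉0 (K.trans (KSolver.solve 0
            ((KSolver.con 1 KSolver.:+ KSolver.con 1) KSolver.:* (KSolver.con 1 KSolver.:+ KSolver.con 1)
              KSolver.:= KSolver.con 4) K.refl) eq)

        a+a≉0 : ¬ a K.+ a K.≈ K.0#
        a+a≉0 eq = *-nonzero 2≉0 a≉0 (K.trans (KSolver.solve 1 (λ a →
          (KSolver.con 1 KSolver.:+ KSolver.con 1) KSolver.:* a KSolver.:= a KSolver.:+ a) K.refl a) eq)

        -- `f₁` has degree `d` with leading coefficient `a + a`, while its multiple `T` has degree 2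
        -- k + 2, less than `d`. Hence `W` and `T` vanish, although `T` has the nonzero coefficient
        -- `t`.
        absurd : ⊥
        absurd = t≉0 (K.trans (K.sym (top lead-T)) (at T≈0 _))
          where
          W≈0 : W ≈ 0#
          W≈0 = below-0 (below-cancel 0 (lead-+ lead-f lead-f̂) (regular a+a≉0)
            (below-mono (ℕ.≤-trans 2k+3≤d (ℕ.m≤m+n d 0)) (below-resp (sym f₁*W≈T) (bound lead-T))))
          T≈0 : T ≈ 0#
          T≈0 = trans (sym f₁*W≈T) (trans (*-congˡ W≈0) (zeroʳ f₁))

      no-range-sum-p : ⊥
      no-range-sum-p with ∏lin-divides (h * P) distinct-points (on-points (h * P) h*P-root)
      ... | E , h*P≈D*E = absurd h*P≈D*E

open import Defs
open import Data.Nat using (ℕ; suc; _<_; _+_; _/_; NonZero)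
open import Data.Nat.Primality using (Prime)
open import Data.Fin using (Fin)
open import Data.Vec using (Vec)
open import Relation.Nullary using (¬_)
open import Relation.Binary.PropositionalEquality using (_≡_)

open import Data.Fin using (toℕ)
open import Data.Fin.Properties using (toℕ<n)
open import Data.Nat.Primality using (euclidsLemma; prime⇒irreducible)
open import Data.Vec using ([]; _∷_; last)

-- The integers modulo p

module Modular (p : ℕ) where

  infix 4 _≈_
  -- The prime field is ℤ up to congruence, so the ring laws come from ℤ. The explicit quotient
  -- reduces compatibility with the operations to integer identities for the solver.
  record _≈_ (x y : ℤ) : Set where
    constructor by
    field
      quotient : ℤ
      equality : x ≡ y ℤ.+ quotient ℤ.* + p

  open ℤSolver.+-*-Solver using (solve; _:=_; _:+_; _:*_; :-_)

  ≡⇒≈ : ∀ {x y} → x ≡ y → x ≈ y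
  ≡⇒≈ {x} {y} eq = by (+ 0) (≡.trans eq (≡.sym (ℤ.+-identityʳ y)))

  ≈-sym : ∀ {x y} → x ≈ y → y ≈ x
  ≈-sym {y = y} (by q ≡.refl) = by (ℤ.- q)
    (solve 3 (λ y q p → y := y :+ q :* p :+ (:- q) :* p) ≡.refl y q (+ p))

  ≈-trans : ∀ {x y z} → x ≈ y → y ≈ z → x ≈ z
  ≈-trans {z = z} (by q ≡.refl) (by q′ ≡.refl) = by (q ℤ.+ q′)
    (solve 4 (λ z q q′ p → z :+ q′ :* p :+ q :* p := z :+ (q :+ q′) :* p) ≡.refl z q q′ (+ p))

  +-cong : ∀ {x x′ y y′} → x ≈ x′ → y ≈ y′ → x ℤ.+ y ≈ x′ ℤ.+ y′
  +-cong {x′ = x} {y′ = y} (by q ≡.refl) (by q′ ≡.refl) = by (q ℤ.+ q′)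
    (solve 5 (λ x y q q′ p → x :+ q :* p :+ (y :+ q′ :* p) := x :+ y :+ (q :+ q′) :* p)
      ≡.refl x y q q′ (+ p))

  *-cong : ∀ {x x′ y y′} → x ≈ x′ → y ≈ y′ → x ℤ.* y ≈ x′ ℤ.* y′
  *-cong {x′ = x} {y′ = y} (by q ≡.refl) (by q′ ≡.refl) =
    by (q ℤ.* y ℤ.+ x ℤ.* q′ ℤ.+ q ℤ.* q′ ℤ.* + p)
    (solve 5 (λ x y q q′ p → (x :+ q :* p) :* (y :+ q′ :* p)
        := x :* y :+ (q :* y :+ x :* q′ :+ q :* q′ :* p) :* p)
      ≡.refl x y q q′ (+ p))

  -‿cong : ∀ {x y} → x ≈ y → ℤ.- x ≈ ℤ.- y
  -‿cong {y = y} (by q ≡.refl) = by (ℤ.- q)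
    (solve 3 (λ y q p → :- (y :+ q :* p) := :- y :+ (:- q) :* p) ≡.refl y q (+ p))

  ring : CommutativeRing _ _
  ring = record
    { Carrier = ℤ ; _≈_ = _≈_ ; _+_ = ℤ._+_ ; _*_ = ℤ._*_ ; -_ = ℤ.-_ ; 0# = + 0 ; 1# = + 1
    ; isCommutativeRing = record
      { isRing = record
        { +-isAbelianGroup = record
          { isGroup = record
            { isMonoid = record
              { isSemigroup = record
                { isMagma = record
                  { isEquivalence = record { refl = ≡⇒≈ ≡.refl ; sym = ≈-sym ; trans = ≈-trans }
                  ; ∙-cong = +-cong
                  }
                ; assoc = λ x y z → ≡⇒≈ (ℤ.+-assoc x y z)
                }
              ; identity = (λ x → ≡⇒≈ (ℤ.+-identityˡ x)) , (λ x → ≡⇒≈ (ℤ.+-identityʳ x))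
              }
            ; inverse = (λ x → ≡⇒≈ (ℤ.+-inverseˡ x)) , (λ x → ≡⇒≈ (ℤ.+-inverseʳ x))
            ; ⁻¹-cong = -‿cong
            }
          ; comm = λ x y → ≡⇒≈ (ℤ.+-comm x y)
          }
        ; *-cong = *-cong
        ; *-assoc = λ x y z → ≡⇒≈ (ℤ.*-assoc x y z)
        ; *-identity = (λ x → ≡⇒≈ (ℤ.*-identityˡ x)) , (λ x → ≡⇒≈ (ℤ.*-identityʳ x))
        ; distrib = (λ x y z → ≡⇒≈ (ℤ.*-distribˡ-+ x y z)) , (λ x y z → ≡⇒≈ (ℤ.*-distribʳ-+ x y z))
        }
      ; *-comm = λ x y → ≡⇒≈ (ℤ.*-comm x y)
      }
    }

  ≈0⇒∣ : ∀ {x} → x ≈ + 0 → p ∣ ℤ.∣ x ∣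
  ≈0⇒∣ (by q eq) = ℤ.∣⇒∣ᵤ {+ p} (ℤ.divides q (≡.trans eq (ℤ.+-identityˡ _)))

  ∣⇒≈0 : ∀ {x} → p ∣ ℤ.∣ x ∣ → x ≈ + 0
  ∣⇒≈0 p∣x with ℤ.∣ᵤ⇒∣ {+ p} p∣x
  ... | ℤ.divides q eq = by q (≡.trans eq (≡.sym (ℤ.+-identityˡ _)))

  regular : Prime p → ∀ {x} → ¬ x ≈ + 0 → ∀ {y} → x ℤ.* y ≈ + 0 → y ≈ + 0
  regular isPrime {x} x≉0 {y} xy≈0
    with euclidsLemma ℤ.∣ x ∣ ℤ.∣ y ∣ isPrime (≡.subst (p ∣_) (ℤ.abs-* x y) (≈0⇒∣ xy≈0))
  ... | inj₁ p∣x = ⊥-elim (x≉0 (∣⇒≈0 p∣x))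
  ... | inj₂ p∣y = ∣⇒≈0 p∣y

  +n≉0 : ∀ {n} → 0 < n → n < p → ¬ + n ≈ + 0
  +n≉0 {suc n} _ n<p n≈0 = >⇒∤ n<p (≈0⇒∣ n≈0)

  +n≈+[n%p] : .{{_ : NonZero p}} → ∀ n → + n ≈ + (n % p)
  +n≈+[n%p] n = by (+ (n / p)) (≡.trans (≡.cong +_ (m≡m%n+[m/n]*n n p))
    (≡.trans (ℤ.pos-+ (n % p) _) (≡.cong (ℤ._+_ (+ (n % p))) (ℤ.pos-* (n / p) p))))

  open PrimeCharacteristic ring using (ι) public

  ι≡+ : ∀ n → ι n ≡ + n
  ι≡+ zero    = ≡.refl
  ι≡+ (suc n) = ≡.cong (ℤ._+_ (+ 1)) (ι≡+ n)

  -- Coefficient vectors as polynomials modulo p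

  open Polynomial ring using (Poly; coeff; eval)
  open PolynomialTheory ring using (Lead; lead; below-length; below-mono)

  fromVec : ∀ {n} → Vec (Fin p) n → Poly
  fromVec []       = []
  fromVec (c ∷ cs) = + toℕ c ∷ fromVec cs

  length-fromVec : ∀ {n} (cs : Vec (Fin p) n) → length (fromVec cs) ≡ n
  length-fromVec []       = ≡.refl
  length-fromVec (c ∷ cs) = ≡.cong suc (length-fromVec cs)

  lead-fromVec : ∀ d (cs : Vec (Fin p) (suc d)) → Lead (fromVec cs) d (+ toℕ (last cs))
  lead-fromVec d cs =
    lead (below-mono (ℕ.≤-reflexive (length-fromVec cs)) (below-length (fromVec cs))) (≡⇒≈ (go d cs))
    where
    go : ∀ d (cs : Vec (Fin p) (suc d)) → coeff (fromVec cs) d ≡ + toℕ (last cs)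
    go zero    (c ∷ [])      = ≡.refl
    go (suc d) (c ∷ c′ ∷ cs) = go d (c′ ∷ cs)

  eval-fromVec : ∀ {n} (cs : Vec (Fin p) n) x → eval (fromVec cs) (+ x) ≡ + evalℕ cs x
  eval-fromVec []       x = ≡.refl
  eval-fromVec (c ∷ cs) x = ≡.trans
    (≡.cong (λ v → + toℕ c ℤ.+ + x ℤ.* v) (eval-fromVec cs x))
    (≡.trans (≡.cong (ℤ._+_ (+ toℕ c)) (≡.sym (ℤ.pos-* x _))) (≡.sym (ℤ.pos-+ (toℕ c) _)))

  -- Evaluation over ℤ agrees exactly with `evalℕ`; the only genuine congruence is the final
  -- reduction modulo `p`.
  eval-ι : .{{_ : NonZero p}} → ∀ {n} (cs : Vec (Fin p) n) x → eval (fromVec cs) (ι x) ≈ ι (evalFp cs x)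
  eval-ι cs x rewrite ι≡+ x | ι≡+ (evalFp cs x) | eval-fromVec cs x = +n≈+[n%p] (evalℕ cs x)

-- An even prime equals 2, so `p` is odd here and the truncating division of `p + 1` by 2 is exact.
prime>2⇒odd : ∀ {p} → Prime p → 2 < p → (p + 1) / 2 + (p + 1) / 2 ≡ suc p
prime>2⇒odd {p} isPrime 2<p with p % 2 in eq
... | 0 with prime⇒irreducible isPrime (m%n≡0⇒n∣m p 2 eq)
...   | inj₂ ≡.refl = ⊥-elim (ℕ.<-irrefl ≡.refl 2<p)
prime>2⇒odd {p} isPrime 2<p | suc (suc r) = ⊥-elim (ℕ.<⇒≱ (≡.subst (_< 2) eq (m%n<n p 2)) (s≤s (s≤s z≤n)))
prime>2⇒odd {p} isPrime 2<p | 1 = begin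
  (p + 1) / 2 + (p + 1) / 2             ≡⟨ ≡.cong (λ n → n + n) half ⟩
  suc h + suc h                         ≡⟨ double ⟨
  p + 1                                 ≡⟨ ℕ.+-comm p 1 ⟩
  suc p                                 ∎
  where
  open ≡.≡-Reasoning
  h = p / 2
  p+1≡ : p + 1 ≡ suc h ℕ.* 2
  p+1≡ = ≡.trans (ℕ.+-comm p 1) (≡.cong suc (≡.trans (m≡m%n+[m/n]*n p 2) (≡.cong (_+ h ℕ.* 2) eq)))
  double : p + 1 ≡ suc h + suc h
  double = ≡.trans p+1≡ (≡.trans (ℕ.*-comm (suc h) 2) (≡.cong (λ n → suc h + n) (ℕ.+-identityʳ (suc h))))
  half : (p + 1) / 2 ≡ suc h
  half = ≡.trans (≡.cong (_/ 2) p+1≡) (m*n/n≡m (suc h) 2)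

theorem1 : (p : ℕ) .{{_ : NonZero p}} → Prime p → 32 < p →
    (f : Vec (Fin p) (suc ((p + 1) / 2))) →
    HasDegree ((p + 1) / 2) f → ¬ (rangeSum f ≡ p)
theorem1 p isPrime 32<p f lc≢0 sum≡p =
  PrimeCharacteristic.no-range-sum-p ring (regular isPrime) p (ℕ.≤-trans (s≤s (s≤s z≤n)) 32<p)
    (≡.subst (_≈ + 0) (≡.sym (ι≡+ p)) (by (+ 1) (≡.sym (≡.trans (ℤ.+-identityˡ _) (ℤ.*-identityˡ (+ p))))))
    (λ {n} 0<n n<p → ≡.subst (λ x → ¬ x ≈ + 0) (≡.sym (ι≡+ n)) (+n≉0 0<n n<p))
    -- The last coefficient lies strictly between 0 and `p`, so it is nonzero modulo `p` too.
    (lead-fromVec d f) (+n≉0 (ℕ.n≢0⇒n>0 lc≢0) (toℕ<n (last f)))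
    d+d≡1+p 16<d
    (evalFp f) (λ x _ → eval-ι f x) sum≡p
  where
  open Modular p
  d = (p + 1) / 2
  d+d≡1+p : d + d ≡ suc p
  d+d≡1+p = prime>2⇒odd isPrime (ℕ.≤-trans (s≤s (s≤s (s≤s z≤n))) 32<p)
  16<d : 16 < d
  -- If `d ≤ 16`, then `p + 1 = d + d ≤ 32`, against `32 < p`.
  16<d = ℕ.≰⇒> λ d≤16 → ℕ.<⇒≱ (ℕ.m<n⇒m<1+n 32<p) (≡.subst (_≤ 32) d+d≡1+p (ℕ.+-mono-≤ d≤16 d≤16))
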